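{- Let $r,s,t$ and $n$ be positive integers. Then $$\sum_{k=-n}^{n}(-1)^k\binom{6n}{3n+k}^r\binom{4n}{2n+k}^s\binom{2n}{n+k}^t\equiv 0\pmod{2\binom{6n}{n}}$$ and $$\sum_{k=-n}^{n}(-1)^k\binom{6n}{3n+k}^r\binom{4n}{2n+k}^s\binom{2n}{n+k}^t\equiv 0\pmod{6\binom{6n}{3n}}.$$ Furthermore, if $(r,s,t)\neq(1,1,1)$, then $$\sum_{k=-n}^{n}(-1)^k\binom{8n}{4n+k}^r\binom{4n}{2n+k}^s\binom{2n}{n+k}^t\equiv 0\pmod{2\binom{8n}{3n}}.$$
   Context: All congruences are between integers; the binomial coefficients are the ordinary ones. -}

module Defs where

open import Data.Integer.Base using (ℤ; +_; -[1+_]; -1ℤ; 0ℤ; ∣_∣; _+_; _-_; _^_)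
open import Data.Integer.Divisibility.Signed using (_∣_)
open import Data.List.Base using (List; foldr; map; upTo)
open import Data.Nat.Base as ℕ using (ℕ; suc)
open import Data.Nat.Combinatorics using (_C_)

infix 4 _≡_[mod_]

_≡_[mod_] : ℤ → ℤ → ℕ → Set
a ≡ b [mod m ] = + m ∣ a - b

-- Binomial coefficient with an integer lower index, zero when that index is
-- negative.
binom : ℕ → ℤ → ℤ
binom m (+ j)    = + (m C j)
binom m -[1+ _ ] = 0ℤ

-- (-1)^k for an integer k; the exponent matters only up to parity, and k and
-- ∣ k ∣ have the same parity.
[-1]^_ : ℤ → ℤ
[-1]^ k = -1ℤ ^ ∣ k ∣

-- The integers -n, …, n in increasing order.
range± : ℕ → List ℤ
range± n = map (λ i → + i - + n) (upTo (suc (2 ℕ.* n)))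

∑±[_] : ℕ → (ℤ → ℤ) → ℤ
∑±[ n ] f = foldr _+_ 0ℤ (map f (range± n))

{-# OPTIONS --safe #-}

-- For a cycle n₁, …, nₘ of positive integers, the sum
--   S = Σₖ (-1)ᵏ Πᵢ (nᵢ + nᵢ₊₁ choose nᵢ + k)
-- equals (nₘ + n₁ choose n₁) · Z with
--   Z = Σ Πᵢ (λᵢ₋₁ choose λᵢ) (nᵢ₊₁ + nᵢ₊₂ choose nᵢ₊₁ - λᵢ),   λ₀ = n₁,
-- summed over λ₁, …, λₘ₋₂: Vandermonde's identity replaces n₁, n₂ in the cycle by λ₁
-- (Guo, Jouhet, Zeng).  Up to factorials, Πᵢ (2nᵢ choose nᵢ + k) is the summand of S.  Hence
-- the alternating sum of the theorem is Q · Z, where Q = (6n choose n) for the cycle with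
-- blocks 2n, 3n, n; Q = (6n choose 3n) for 2n, n, 3n and for 3n, n, 2n; Q = (8n choose 3n)
-- for 4n, n, 2n and for 2n, n, 4n.  It remains to divide Z by p = 2 or p = 3.  For a power q
-- of p, p divides (N choose j) whenever q ∣ N and q ∤ j.  So if q ∣ n₁, only λᵢ divisible by q
-- matter modulo p, and an edge with q ∣ nᵢ + nᵢ₊₁ but q ∤ nᵢ₊₁ forces p ∣ Z.  For q the least
-- power of p not dividing n (or 2n) such an edge exists, except for 8n with s = t = 1; there
-- the sum over λ₁ is evaluated in closed form and each term that remains is even by Lucas's
-- theorem.
module Submission where

open import Data.Empty using (⊥)
open import Data.Fin.Base using (toℕ)
open import Data.Fin.Properties using (toℕ<n)
open import Data.List.Base using (List; []; _∷_; _++_; replicate; foldr; map; applyUpTo; upTo)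
open import Data.List.Properties using (map-applyUpTo)
open import Data.Nat.Base as ℕ using (ℕ; zero; suc; _≤_; _<_; _≥_; z≤n; s≤s; _!)
open import Data.Nat.Combinatorics
  using (_C_; nC1≡n; k>n⇒nCk≡0; nCk≡nC[n∸k]; nCk+nC[k+1]≡[n+1]C[k+1]; nCk≡n!/k![n-k]!; k![n∸k]!∣n!)
import Data.Nat.Divisibility as ℕ
open import Data.Nat.Induction using (<-rec)
open import Data.Nat.Primality
  using (Prime; prime?; prime[2]; euclidsLemma; prime⇒nonZero; prime⇒nonTrivial)
import Data.Nat.Properties as ℕ
import Data.Nat.Tactic.RingSolver as ℕ-Solver
open import Data.Product using (_×_; _,_; ∃)
open import Data.Sum.Base using (_⊎_; inj₁; inj₂)
open import Function.Base using (_∘_)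
open import Relation.Binary.PropositionalEquality
open import Relation.Nullary using (yes; no; ¬_; contradiction)
open import Relation.Nullary.Decidable using (from-yes)
open ≡-Reasoning

-- Binomial coefficients and trinomial identities

module Binomial where
  open import Data.Nat.Base using (_+_; _*_; _∸_; NonZero; _/_)
  open import Data.Nat.Tactic.RingSolver using (solve-∀)
  open import Data.Nat.DivMod using (m/n*n≡m)

  infixl 9 _choose_

  -- Opaque, and binding tighter than _*_; unfolding _C_ exposes a division.
  opaque
    _choose_ : ℕ → ℕ → ℕ
    n choose k = n C k

    choose≡C : ∀ n k → n choose k ≡ n C k
    choose≡C n k = refl

    nchoose0≡1 : ∀ n → n choose 0 ≡ 1
    nchoose0≡1 n = refl

    nchoose1≡n : ∀ n → n choose 1 ≡ n
    nchoose1≡n = nC1≡n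

    k>n⇒nchoosek≡0 : ∀ {n k} → n < k → n choose k ≡ 0
    k>n⇒nchoosek≡0 = k>n⇒nCk≡0

    pascal : ∀ n k → suc n choose suc k ≡ n choose k + n choose suc k
    pascal n k = sym (nCk+nC[k+1]≡[n+1]C[k+1] n k)

    choose-! : ∀ m n → (m + n) choose m * (m ! * n !) ≡ (m + n) !
    choose-! m n = begin
      (m + n) choose m * (m ! * n !)                ≡⟨ cong (λ i → (m + n) choose m * (m ! * i !)) (ℕ.m+n∸m≡n m n) ⟨
      (m + n) choose m * (m ! * (m + n ∸ m) !)      ≡⟨ cong (_* (m ! * (m + n ∸ m) !)) (nCk≡n!/k![n-k]! (ℕ.m≤m+n m n)) ⟩
      (m + n) ! / (m ! * (m + n ∸ m) !) * (m ! * (m + n ∸ m) !) ≡⟨ m/n*n≡m (k![n∸k]!∣n! (ℕ.m≤m+n m n)) ⟩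
      (m + n) !                                     ∎
      where
      instance
        m![m+n∸m]!≢0 : NonZero (m ! * (m + n ∸ m) !)
        m![m+n∸m]!≢0 = m ℕ.!* (m + n ∸ m) !≢0

    choose-sym : ∀ m n → (m + n) choose m ≡ (m + n) choose n
    choose-sym m n = trans (nCk≡nC[n∸k] (ℕ.m≤m+n m n)) (cong ((m + n) C_) (ℕ.m+n∸m≡n m n))

  -- For j ≤ p both sides are (x + p)! / (x! j! (p - j)!), which is compared after clearing the
  -- denominator; for j > p both sides vanish.
  trinomial-revision : ∀ x p j → (x + p) choose (x + j) * (x + j) choose x ≡ (x + p) choose x * p choose j
  trinomial-revision x p j with j ℕ.≤? p
  ... | no j≰p = begin
    (x + p) choose (x + j) * (x + j) choose x ≡⟨ cong (_* (x + j) choose x) (k>n⇒nchoosek≡0 (ℕ.+-monoʳ-< x (ℕ.≰⇒> j≰p))) ⟩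
    0                               ≡⟨ ℕ.*-zeroʳ ((x + p) choose x) ⟨
    (x + p) choose x * 0                 ≡⟨ cong ((x + p) choose x *_) (k>n⇒nchoosek≡0 (ℕ.≰⇒> j≰p)) ⟨
    (x + p) choose x * p choose j             ∎
  ... | yes j≤p with i , refl ← ℕ.m≤n⇒∃[o]m+o≡n j≤p =
    ℕ.*-cancelʳ-≡ _ _ (x ! * (j ! * i !)) {{ℕ.m*n≢0 _ _ {{x ℕ.!≢0}} {{j ℕ.!* i !≢0}}}} (begin
      c₁ * c₂ * (x ! * (j ! * i !))   ≡⟨ shuffle₁ c₁ c₂ (x !) (j !) (i !) ⟩
      c₁ * (c₂ * (x ! * j !) * i !)   ≡⟨ cong (λ y → c₁ * (y * i !)) (choose-! x j) ⟩
      c₁ * ((x + j) ! * i !)          ≡⟨ cong (λ y → y choose (x + j) * ((x + j) ! * i !)) (ℕ.+-assoc x j i) ⟨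
      (x + j + i) choose (x + j) * ((x + j) ! * i !) ≡⟨ choose-! (x + j) i ⟩
      (x + j + i) !                   ≡⟨ cong _! (ℕ.+-assoc x j i) ⟩
      (x + (j + i)) !                 ≡⟨ choose-! x (j + i) ⟨
      c₃ * (x ! * (j + i) !)          ≡⟨ cong (λ y → c₃ * (x ! * y)) (choose-! j i) ⟨
      c₃ * (x ! * (c₄ * (j ! * i !))) ≡⟨ shuffle₂ c₃ c₄ (x !) (j ! * i !) ⟩
      c₃ * c₄ * (x ! * (j ! * i !))   ∎)
    where
    c₁ = (x + (j + i)) choose (x + j)
    c₂ = (x + j) choose x
    c₃ = (x + (j + i)) choose x
    c₄ = (j + i) choose j

    shuffle₁ : ∀ a b c d e → a * b * (c * (d * e)) ≡ a * (b * (c * d) * e)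
    shuffle₁ = solve-∀

    shuffle₂ : ∀ a b c d → a * (c * (b * d)) ≡ a * b * (c * d)
    shuffle₂ = solve-∀

  -- Both sides are the multinomial coefficient with parts k + l, b - l and x - k, reached by
  -- splitting off x - k first on the left and b - l first on the right. If one of these parts would
  -- be negative, both sides are 0.
  trinomial-exchange : ∀ b x k l →
    (b + x) choose (b + k) * (b + k) choose (k + l) ≡ (b + x) choose (x + l) * (l + x) choose (l + k)
  trinomial-exchange b x k l with k ℕ.≤? x | l ℕ.≤? b
  ... | no k≰x | _ = begin
    (b + x) choose (b + k) * (b + k) choose (k + l) ≡⟨ cong (_* (b + k) choose (k + l)) (k>n⇒nchoosek≡0 (ℕ.+-monoʳ-< b (ℕ.≰⇒> k≰x))) ⟩
    0                                     ≡⟨ ℕ.*-zeroʳ ((b + x) choose (x + l)) ⟨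
    (b + x) choose (x + l) * 0                 ≡⟨ cong ((b + x) choose (x + l) *_) (k>n⇒nchoosek≡0 (ℕ.+-monoʳ-< l (ℕ.≰⇒> k≰x))) ⟨
    (b + x) choose (x + l) * (l + x) choose (l + k) ∎
  ... | yes _ | no l≰b = begin
    (b + x) choose (b + k) * (b + k) choose (k + l) ≡⟨ cong ((b + x) choose (b + k) *_) (k>n⇒nchoosek≡0 (subst (_< k + l) (ℕ.+-comm k b) (ℕ.+-monoʳ-< k (ℕ.≰⇒> l≰b)))) ⟩
    (b + x) choose (b + k) * 0                 ≡⟨ ℕ.*-zeroʳ ((b + x) choose (b + k)) ⟩
    0 * (l + x) choose (l + k)                 ≡⟨ cong (_* (l + x) choose (l + k)) (k>n⇒nchoosek≡0 (subst (_< x + l) (ℕ.+-comm x b) (ℕ.+-monoʳ-< x (ℕ.≰⇒> l≰b)))) ⟨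
    (b + x) choose (x + l) * (l + x) choose (l + k) ∎
  ... | yes k≤x | yes l≤b
    with x′ , refl ← ℕ.m≤n⇒∃[o]m+o≡n k≤x | b′ , refl ← ℕ.m≤n⇒∃[o]m+o≡n l≤b = begin
    (l + b′ + (k + x′)) choose (l + b′ + k) * (l + b′ + k) choose v
      ≡⟨ cong₂ (λ s t → s choose t * t choose v) (e₁ l b′ k x′) (e₂ l b′ k) ⟩
    (v + (b′ + x′)) choose (v + b′) * (v + b′) choose v
      ≡⟨ trinomial-revision v (b′ + x′) b′ ⟩
    (v + (b′ + x′)) choose v * (b′ + x′) choose b′
      ≡⟨ cong ((v + (b′ + x′)) choose v *_) (choose-sym b′ x′) ⟩
    (v + (b′ + x′)) choose v * (b′ + x′) choose x′
      ≡⟨ trinomial-revision v (b′ + x′) x′ ⟨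
    (v + (b′ + x′)) choose (v + x′) * (v + x′) choose v
      ≡⟨ cong₂ (λ s t → s choose t * t choose v) (e₁ l b′ k x′) (e₃ k x′ l) ⟨
    (l + b′ + (k + x′)) choose (k + x′ + l) * (k + x′ + l) choose v
      ≡⟨ cong₂ (λ s t → (l + b′ + (k + x′)) choose (k + x′ + l) * s choose t) (ℕ.+-comm (k + x′) l) (ℕ.+-comm k l) ⟩
    (l + b′ + (k + x′)) choose (k + x′ + l) * (l + (k + x′)) choose (l + k) ∎
    where
    v = k + l

    e₁ : ∀ l b k x → l + b + (k + x) ≡ k + l + (b + x)
    e₁ = solve-∀

    e₂ : ∀ l b k → l + b + k ≡ k + l + b
    e₂ = solve-∀

    e₃ : ∀ k x l → k + x + l ≡ k + l + x
    e₃ = solve-∀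

-- Prime divisors of binomial coefficients

module BinomialDivisibility where
  open import Data.Nat.Base using (_+_; _*_; _^_)
  open import Data.Nat.Divisibility using (_∣_; divides; ∣m∣n⇒∣m+n; ∣m⇒∣m*n; ∣-trans; m∣m*n; *-monoʳ-∣; *-cancelˡ-∣)
  open import Data.Nat.Tactic.RingSolver using (solve-∀)
  open Binomial

  absorption : ∀ n k → suc n choose suc k * suc k ≡ suc n * n choose k
  absorption n k = begin
    suc n choose suc k * suc k     ≡⟨ cong (suc n choose suc k *_) (nchoose1≡n (suc k)) ⟨
    suc n choose suc k * suc k choose 1 ≡⟨ trinomial-revision 1 n k ⟩
    suc n choose 1 * n choose k         ≡⟨ cong (_* n choose k) (nchoose1≡n (suc n)) ⟩
    suc n * n choose k             ∎

  -- Euclid's lemma is applied once per factor of p: either p divides m, or one p is cancelled from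
  -- n and the argument repeats with a smaller exponent.
  prime-power-∣-* : ∀ {p} → Prime p → ∀ f m n → p ^ f ∣ m * n → p ∣ m ⊎ p ^ f ∣ n
  prime-power-∣-* pr zero m n _ = inj₂ (ℕ.1∣ n)
  prime-power-∣-* {p} pr (suc f) m n pᶠ⁺¹∣mn
    with euclidsLemma m n pr (∣-trans (m∣m*n (p ^ f)) pᶠ⁺¹∣mn)
  ... | inj₁ p∣m = inj₁ p∣m
  ... | inj₂ (divides n′ refl)
    with prime-power-∣-* pr f m n′ (*-cancelˡ-∣ p {{prime⇒nonZero pr}} (subst (p ^ suc f ∣_) (trans (sym (ℕ.*-assoc m n′ p)) (ℕ.*-comm (m * n′) p)) pᶠ⁺¹∣mn))
  ...   | inj₁ p∣m   = inj₁ p∣m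
  ...   | inj₂ pᶠ∣n′ = inj₂ (subst (p ^ suc f ∣_) (ℕ.*-comm p n′) (*-monoʳ-∣ p pᶠ∣n′))

  -- By absorption, k times the binomial is a multiple of n, hence of p ^ f; if p misses the
  -- binomial, the whole power must sit in k.
  prime-power-∣-choose : ∀ {p} → Prime p → ∀ f n k → p ^ f ∣ n → p ∣ n choose k ⊎ p ^ f ∣ k
  prime-power-∣-choose pr f n       zero    _    = inj₂ (_ ℕ.∣0)
  prime-power-∣-choose pr f zero    (suc k) _    = inj₁ (subst (_ ∣_) (sym (k>n⇒nchoosek≡0 (s≤s z≤n))) (_ ℕ.∣0))
  prime-power-∣-choose {p} pr f (suc n) (suc k) pᶠ∣n =
    prime-power-∣-* pr f (suc n choose suc k) (suc k) (subst (p ^ f ∣_) (sym (absorption n k)) (∣m⇒∣m*n (n choose k) pᶠ∣n))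

  even-or-odd : ∀ n → (∃ λ h → n ≡ 2 * h) ⊎ (∃ λ h → n ≡ suc (2 * h))
  even-or-odd zero = inj₁ (0 , refl)
  even-or-odd (suc n) with even-or-odd n
  ... | inj₁ (h , refl) = inj₂ (h , refl)
  ... | inj₂ (h , refl) = inj₁ (suc h , sym (ℕ.*-suc 2 h))

  -- Lucas's theorem modulo 2.
  even-choose-even : ∀ n k → ∃ λ y → (2 * n) choose (2 * k) ≡ n choose k + 2 * y
  even-choose-odd  : ∀ n k → 2 ∣ (2 * n) choose suc (2 * k)

  even-choose-even zero    zero    = 0 , sym (ℕ.+-identityʳ _)
  even-choose-even zero    (suc k) = 0 , trans (k>n⇒nchoosek≡0 (s≤s z≤n)) (sym (trans (ℕ.+-identityʳ _) (k>n⇒nchoosek≡0 (s≤s z≤n))))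
  even-choose-even (suc n) zero    = 0 , trans (nchoose0≡1 (2 * suc n)) (sym (trans (ℕ.+-identityʳ _) (nchoose0≡1 (suc n))))
  even-choose-even (suc n) (suc k) with even-choose-even n k | even-choose-even n (suc k)
  ... | y , eq | y′ , eq′ = y + (2 * n) choose suc (2 * k) + y′ , (begin
    (2 * suc n) choose (2 * suc k)
      ≡⟨ cong₂ _choose_ (ℕ.*-suc 2 n) (ℕ.*-suc 2 k) ⟩
    suc (suc (2 * n)) choose suc (suc (2 * k))
      ≡⟨ trans (pascal _ _) (cong₂ _+_ (pascal _ _) (pascal _ _)) ⟩
    (2 * n) choose (2 * k) + c + (c + (2 * n) choose suc (suc (2 * k)))
      ≡⟨ cong (λ i → (2 * n) choose (2 * k) + c + (c + (2 * n) choose i)) (ℕ.*-suc 2 k) ⟨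
    (2 * n) choose (2 * k) + c + (c + (2 * n) choose (2 * suc k))
      ≡⟨ cong₂ (λ s t → s + c + (c + t)) eq eq′ ⟩
    n choose k + 2 * y + c + (c + (n choose suc k + 2 * y′))
      ≡⟨ collect (n choose k) y c (n choose suc k) y′ ⟩
    n choose k + n choose suc k + 2 * (y + c + y′)
      ≡⟨ cong (_+ 2 * (y + c + y′)) (pascal n k) ⟨
    suc n choose suc k + 2 * (y + c + y′) ∎)
    where
    c = (2 * n) choose suc (2 * k)
    collect : ∀ a y c b z → a + 2 * y + c + (c + (b + 2 * z)) ≡ a + b + 2 * (y + c + z)
    collect = solve-∀

  even-choose-odd zero    k       = subst (2 ∣_) (sym (k>n⇒nchoosek≡0 (s≤s z≤n))) (2 ℕ.∣0)
  even-choose-odd (suc n) zero    = subst (2 ∣_) (sym eq) (∣m∣n⇒∣m+n (ℕ.n∣n {2}) (even-choose-odd n 0))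
    where
    eq : (2 * suc n) choose 1 ≡ 2 + (2 * n) choose 1
    eq = trans (cong (_choose 1) (ℕ.*-suc 2 n)) (trans (pascal _ 0) (cong₂ _+_ (nchoose0≡1 (suc (2 * n))) (trans (pascal _ 0) (cong (_+ (2 * n) choose 1) (nchoose0≡1 (2 * n))))))
  even-choose-odd (suc n) (suc k) = subst (2 ∣_) (sym eq)
    (∣m∣n⇒∣m+n (∣m∣n⇒∣m+n (even-choose-odd n k) (m∣m*n c)) (even-choose-odd n (suc k)))
    where
    c = (2 * n) choose (2 * suc k)
    collect : ∀ a b c → a + b + (b + c) ≡ a + 2 * b + c
    collect = solve-∀
    eq : (2 * suc n) choose suc (2 * suc k) ≡ (2 * n) choose suc (2 * k) + 2 * c + (2 * n) choose suc (2 * suc k)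
    eq = begin
      (2 * suc n) choose suc (2 * suc k)
        ≡⟨ cong (_choose suc (2 * suc k)) (ℕ.*-suc 2 n) ⟩
      suc (suc (2 * n)) choose suc (2 * suc k)
        ≡⟨ pascal _ _ ⟩
      suc (2 * n) choose (2 * suc k) + suc (2 * n) choose suc (2 * suc k)
        ≡⟨ cong₂ _+_ (trans (cong (suc (2 * n) choose_) (ℕ.*-suc 2 k)) (pascal _ _)) (pascal _ _) ⟩
      (2 * n) choose suc (2 * k) + (2 * n) choose suc (suc (2 * k)) + (c + (2 * n) choose suc (2 * suc k))
        ≡⟨ cong (λ i → (2 * n) choose suc (2 * k) + (2 * n) choose i + (c + (2 * n) choose suc (2 * suc k))) (ℕ.*-suc 2 k) ⟨
      (2 * n) choose suc (2 * k) + c + (c + (2 * n) choose suc (2 * suc k))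
        ≡⟨ collect ((2 * n) choose suc (2 * k)) c _ ⟩
      (2 * n) choose suc (2 * k) + 2 * c + (2 * n) choose suc (2 * suc k) ∎

  even-choose-even-∣ : ∀ n k → 2 ∣ n choose k → 2 ∣ (2 * n) choose (2 * k)
  even-choose-even-∣ n k 2∣nCk with y , eq ← even-choose-even n k = subst (2 ∣_) (sym eq) (∣m∣n⇒∣m+n 2∣nCk (m∣m*n y))

  odd-choose-even-∣ : ∀ n k → 2 ∣ n choose k → 2 ∣ suc (2 * n) choose (2 * k)
  odd-choose-even-∣ n zero    2∣nCk = subst (2 ∣_) (trans (nchoose0≡1 n) (sym (nchoose0≡1 (suc (2 * n))))) 2∣nCk
  odd-choose-even-∣ n (suc k) 2∣nCk = subst (2 ∣_) (sym eq) (∣m∣n⇒∣m+n (even-choose-odd n k) (even-choose-even-∣ n (suc k) 2∣nCk))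
    where
    eq : suc (2 * n) choose (2 * suc k) ≡ (2 * n) choose suc (2 * k) + (2 * n) choose (2 * suc k)
    eq = begin
      suc (2 * n) choose (2 * suc k)                                ≡⟨ cong (suc (2 * n) choose_) (ℕ.*-suc 2 k) ⟩
      suc (2 * n) choose suc (suc (2 * k))                          ≡⟨ pascal _ _ ⟩
      (2 * n) choose suc (2 * k) + (2 * n) choose suc (suc (2 * k))      ≡⟨ cong (λ i → (2 * n) choose suc (2 * k) + (2 * n) choose i) (ℕ.*-suc 2 k) ⟨
      (2 * n) choose suc (2 * k) + (2 * n) choose (2 * suc k)            ∎

  -- The binomials that remain of the term λ₂ = j for 8n and s = t = 1, with m = 7n - j.
  data Even-among (n j m : ℕ) : Set where
    even₁ : 2 ∣ (2 * n) choose j           → Even-among n j m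
    even₂ : 2 ∣ m choose (6 * n)           → Even-among n j m
    even₃ : 2 ∣ (8 * n) choose (4 * n + j) → Even-among n j m

  -- For n = 4u + 3 and 4 ∣ j, the number m = 7n - j is 1 modulo 4 while 6n is 2 modulo 4. In the
  -- second binary digit 6n has a 1 over which m has a 0, so Lucas's theorem applies.
  choose-6n-even : ∀ u c m → m + 4 * suc (2 * c) ≡ 7 * (4 * u + 3) → 2 ∣ m choose (6 * (4 * u + 3))
  choose-6n-even u c m m+j≡7n = odd (even-or-odd m)
    where
    6n : ∀ u → 6 * (4 * u + 3) ≡ 2 * suc (2 * (6 * u + 4))
    6n = solve-∀
    7n : ∀ u → 7 * (4 * u + 3) ≡ suc (2 * (2 * (7 * u + 5)))
    7n = solve-∀
    m+j-even : ∀ w c → 2 * (w + 2 * suc (2 * c)) ≡ 2 * w + 4 * suc (2 * c)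
    m+j-even = solve-∀
    w+2κ-odd : ∀ x c → suc (2 * (x + suc (2 * c))) ≡ suc (2 * x) + 2 * suc (2 * c)
    w+2κ-odd = solve-∀

    odd′ : ∀ w → w + 2 * suc (2 * c) ≡ 2 * (7 * u + 5) → (∃ λ x → w ≡ 2 * x) ⊎ (∃ λ x → w ≡ suc (2 * x)) →
           2 ∣ suc (2 * w) choose (6 * (4 * u + 3))
    odd′ w _  (inj₁ (x , refl)) = subst (λ t → 2 ∣ suc (2 * w) choose t) (sym (6n u))
      (odd-choose-even-∣ w (suc (2 * (6 * u + 4))) (even-choose-odd x (6 * u + 4)))
    odd′ w eq (inj₂ (x , refl)) with () ←
      ℕ.even≢odd (7 * u + 5) (x + suc (2 * c)) (sym (trans (w+2κ-odd x c) eq))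

    odd : (∃ λ w → m ≡ 2 * w) ⊎ (∃ λ w → m ≡ suc (2 * w)) → 2 ∣ m choose (6 * (4 * u + 3))
    odd (inj₁ (w , refl)) with () ←
      ℕ.even≢odd (w + 2 * suc (2 * c)) (2 * (7 * u + 5)) (trans (m+j-even w c) (trans m+j≡7n (7n u)))
    odd (inj₂ (w , refl)) = odd′ w
      (ℕ.*-cancelˡ-≡ (w + 2 * suc (2 * c)) (2 * (7 * u + 5)) 2
        (trans (m+j-even w c) (ℕ.suc-injective (trans m+j≡7n (7n u)))))
      (even-or-odd w)

  -- For odd n the low binary digits of j decide. If j is odd, compare it with 2n. If j ≡ 2 modulo 4
  -- or j ≡ 0 modulo 8, then 4n + j is not divisible by 8, but 8n is. If j ≡ 4 modulo 8, then n ≡ 1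
  -- modulo 4 gives 2n ≡ 2 modulo 8, which lacks the digit 4 of j, and n ≡ 3 modulo 4 is
  -- `choose-6n-even`.
  odd-even-among : ∀ h j m → m + j ≡ 7 * suc (2 * h) → Even-among (suc (2 * h)) j m
  odd-even-among h j m m+j≡7n with even-or-odd j
  ... | inj₂ (i , refl) = even₁ (even-choose-odd (suc (2 * h)) i)
  ... | inj₁ (i , refl) with even-or-odd i
  ...   | inj₂ (u , refl) = even₃ (subst₂ (λ s t → 2 ∣ s choose t) (8n h) (4n+2i h u)
            (even-choose-even-∣ (2 * (2 * n)) (suc (2 * (n + u))) (even-choose-odd (2 * n) (n + u))))
    where
    n = suc (2 * h)
    8n : ∀ h → 2 * (2 * (2 * suc (2 * h))) ≡ 8 * suc (2 * h)
    8n = solve-∀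
    4n+2i : ∀ h u → 2 * suc (2 * (suc (2 * h) + u)) ≡ 4 * suc (2 * h) + 2 * suc (2 * u)
    4n+2i = solve-∀
  ...   | inj₁ (κ , refl) with even-or-odd κ
  ...     | inj₁ (v , refl) = even₃ (subst₂ (λ s t → 2 ∣ s choose t) (8n h) (4n+8v h v)
              (even-choose-even-∣ (2 * (2 * n)) (2 * suc (2 * (h + v)))
                (even-choose-even-∣ (2 * n) (suc (2 * (h + v))) (even-choose-odd n (h + v)))))
    where
    n = suc (2 * h)
    8n : ∀ h → 2 * (2 * (2 * suc (2 * h))) ≡ 8 * suc (2 * h)
    8n = solve-∀
    4n+8v : ∀ h v → 2 * (2 * suc (2 * (h + v))) ≡ 4 * suc (2 * h) + 2 * (2 * (2 * v))
    4n+8v = solve-∀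
  ...     | inj₂ (c , refl) with even-or-odd h
  ...       | inj₁ (u , refl) = even₁ (even-choose-even-∣ (suc (2 * h)) (2 * suc (2 * c))
                (odd-choose-even-∣ h (suc (2 * c)) (even-choose-odd u c)))
  ...       | inj₂ (u , refl) = even₂ (subst (λ t → 2 ∣ m choose (6 * t)) (n≡4u+3 u)
                (choose-6n-even u c m (trans (cong (m +_) (4κ c)) (trans m+j≡7n (cong (7 *_) (sym (n≡4u+3 u)))))))
    where
    n≡4u+3 : ∀ u → 4 * u + 3 ≡ suc (2 * suc (2 * u))
    n≡4u+3 = solve-∀
    4κ : ∀ c → 4 * suc (2 * c) ≡ 2 * (2 * suc (2 * c))
    4κ = solve-∀

  -- Descent on the power of 2 in n. For even n an odd j is settled at once; for even j the relation
  -- m + j = 7n makes m even too, so all indices can be halved and Lucas's theorem carries the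
  -- parity back up.
  even-among : ∀ n j m → n ≢ 0 → m + j ≡ 7 * n → Even-among n j m
  even-among = <-rec _ step
    where
    step : ∀ n → (∀ {h} → h < n → ∀ j m → h ≢ 0 → m + j ≡ 7 * h → Even-among h j m) →
           ∀ j m → n ≢ 0 → m + j ≡ 7 * n → Even-among n j m
    step n rec j m n≢0 m+j≡7n with even-or-odd n
    ... | inj₂ (h , refl) = odd-even-among h j m m+j≡7n
    ... | inj₁ (zero , refl) with () ← n≢0 refl
    ... | inj₁ (h@(suc _) , refl) with even-or-odd j
    ...   | inj₂ (i , refl) = even₁ (even-choose-odd (2 * h) i)
    ...   | inj₁ (i , refl) = go (even-or-odd m)
      where
      7n : ∀ h → 7 * (2 * h) ≡ 2 * (7 * h)
      7n = solve-∀
      6n : ∀ h → 2 * (6 * h) ≡ 6 * (2 * h)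
      6n = solve-∀
      8n : ∀ h → 2 * (8 * h) ≡ 8 * (2 * h)
      8n = solve-∀
      4n+j : ∀ h i → 2 * (4 * h + i) ≡ 4 * (2 * h) + 2 * i
      4n+j = solve-∀

      go : (∃ λ w → m ≡ 2 * w) ⊎ (∃ λ w → m ≡ suc (2 * w)) → Even-among (2 * h) (2 * i) m
      go (inj₂ (w , refl))
        with () ← ℕ.even≢odd (7 * h) (w + i)
                    (trans (sym (7n h)) (trans (sym m+j≡7n) (cong suc (sym (ℕ.*-distribˡ-+ 2 w i)))))
      go (inj₁ (w , refl))
        with rec (ℕ.m<m+n h (s≤s z≤n)) i w (λ ())
                 (ℕ.*-cancelˡ-≡ (w + i) (7 * h) 2 (trans (ℕ.*-distribˡ-+ 2 w i) (trans m+j≡7n (7n h))))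
      ... | even₁ even = even₁ (even-choose-even-∣ (2 * h) i even)
      ... | even₂ even = even₂ (subst (λ t → 2 ∣ (2 * w) choose t) (6n h) (even-choose-even-∣ w (6 * h) even))
      ... | even₃ even = even₃ (subst₂ (λ s t → 2 ∣ s choose t) (8n h) (4n+j h i)
              (even-choose-even-∣ (8 * h) (4 * h + i) even))

open import Defs
open import Data.Integer.Base using (ℤ; +_; -[1+_]; 0ℤ; 1ℤ; -1ℤ; _+_; _*_; _^_; -_; _-_; _⊖_)
open import Data.Integer.Divisibility.Signed
  using (_∣_; divides; ∣m∣n⇒∣m+n; ∣n⇒∣m*n; ∣m⇒∣m*n; ∣ᵤ⇒∣)
import Data.Integer.Properties as ℤ
open import Data.Integer.Tactic.RingSolver using (solve-∀)
open import Algebra.Properties.Semiring.Sum ℤ.+-*-semiring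
  using (sum; sum-cong-≗; sum-replicate-zero; *-distribˡ-sum; *-distribʳ-sum; ∑-comm; ∑-distrib-+)
open Binomial
open BinomialDivisibility

-- Finite sums of integers

opaque
  ∑ : ℕ → (ℕ → ℤ) → ℤ
  ∑ n f = sum {n} (f ∘ toℕ)

syntax ∑ n (λ k → e) = ∑[ k < n ] e

opaque
  unfolding ∑

  ∑-empty : ∀ f → ∑ 0 f ≡ 0ℤ
  ∑-empty f = refl

  ∑-head : ∀ n f → ∑ (suc n) f ≡ f 0 + ∑[ k < n ] f (suc k)
  ∑-head n f = refl

  ∑-cong : ∀ n {f g : ℕ → ℤ} → (∀ k → k < n → f k ≡ g k) → ∑ n f ≡ ∑ n g
  ∑-cong n f≗g = sum-cong-≗ {n} (λ i → f≗g (toℕ i) (toℕ<n i))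

  ∑-zero : ∀ n {f : ℕ → ℤ} → (∀ k → k < n → f k ≡ 0ℤ) → ∑ n f ≡ 0ℤ
  ∑-zero n f≗0 = trans (∑-cong n f≗0) (sum-replicate-zero n)

  ∑-distribˡ : ∀ n c (f : ℕ → ℤ) → c * ∑ n f ≡ ∑[ k < n ] (c * f k)
  ∑-distribˡ n c f = *-distribˡ-sum {n} c (f ∘ toℕ)

  ∑-distribʳ : ∀ n c (f : ℕ → ℤ) → ∑ n f * c ≡ ∑[ k < n ] (f k * c)
  ∑-distribʳ n c f = *-distribʳ-sum {n} c (f ∘ toℕ)

  ∑-swap : ∀ m n (f : ℕ → ℕ → ℤ) → ∑[ i < m ] ∑[ j < n ] f i j ≡ ∑[ j < n ] ∑[ i < m ] f i j
  ∑-swap m n f = ∑-comm {m} {n} (λ i j → f (toℕ i) (toℕ j))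

  ∑-+ : ∀ n (f g : ℕ → ℤ) → ∑[ k < n ] (f k + g k) ≡ ∑ n f + ∑ n g
  ∑-+ n f g = ∑-distrib-+ {n} (f ∘ toℕ) (g ∘ toℕ)

  ∑-last : ∀ n (f : ℕ → ℤ) → ∑ (suc n) f ≡ ∑ n f + f n
  ∑-last zero    f = ℤ.+-comm (f 0) 0ℤ
  ∑-last (suc n) f = trans (cong (λ y → f 0 + y) (∑-last n (f ∘ suc))) (sym (ℤ.+-assoc (f 0) _ _))

  ∑-shift : ∀ k {n} (f : ℕ → ℤ) → (∀ i → i < k → f i ≡ 0ℤ) → ∑ (k ℕ.+ n) f ≡ ∑[ i < n ] f (k ℕ.+ i)
  ∑-shift zero        f f≡0 = refl
  ∑-shift (suc k) {n} f f≡0 = begin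
    f 0 + ∑ (k ℕ.+ n) (f ∘ suc)
      ≡⟨ cong₂ _+_ (f≡0 0 (s≤s z≤n)) (∑-shift k (f ∘ suc) (λ i i<k → f≡0 (suc i) (s≤s i<k))) ⟩
    0ℤ + ∑[ i < n ] f (suc k ℕ.+ i)
      ≡⟨ ℤ.+-identityˡ _ ⟩
    ∑[ i < n ] f (suc k ℕ.+ i) ∎

  ∑-truncate : ∀ {m n} (f : ℕ → ℤ) → m ≤ n → (∀ k → m ≤ k → k < n → f k ≡ 0ℤ) → ∑ n f ≡ ∑ m f
  ∑-truncate {n = n} f z≤n       f≡0 = ∑-zero n (λ k → f≡0 k z≤n)
  ∑-truncate         f (s≤s m≤n) f≡0 =
    cong (λ y → f 0 + y) (∑-truncate (f ∘ suc) m≤n (λ k m≤k k<n → f≡0 (suc k) (s≤s m≤k) (s≤s k<n)))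

  ∑-∣ : ∀ n {d} {f : ℕ → ℤ} → (∀ k → d ∣ f k) → d ∣ ∑ n f
  ∑-∣ zero    d∣f = divides 0ℤ refl
  ∑-∣ (suc n) d∣f = ∣m∣n⇒∣m+n (d∣f 0) (∑-∣ n (d∣f ∘ suc))

-- Integer-valued binomials and Vandermonde's identity

infixl 9 _Cℤ_

opaque
  _Cℤ_ : ℕ → ℕ → ℤ
  n Cℤ k = + (n choose k)

  Cℤ≡choose : ∀ n k → n Cℤ k ≡ + (n choose k)
  Cℤ≡choose n k = refl

  nCℤ0≡1 : ∀ n → n Cℤ 0 ≡ 1ℤ
  nCℤ0≡1 n = cong +_ (nchoose0≡1 n)

  Cℤ-zero : ∀ {n k} → n < k → n Cℤ k ≡ 0ℤ
  Cℤ-zero n<k = cong +_ (k>n⇒nchoosek≡0 n<k)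

  Cℤ-pascal : ∀ n k → suc n Cℤ suc k ≡ n Cℤ k + n Cℤ suc k
  Cℤ-pascal n k = cong +_ (pascal n k)

  Cℤ-sym : ∀ m n → (m ℕ.+ n) Cℤ m ≡ (m ℕ.+ n) Cℤ n
  Cℤ-sym m n = cong +_ (choose-sym m n)

  Cℤ-revision : ∀ x p j → (x ℕ.+ p) Cℤ (x ℕ.+ j) * (x ℕ.+ j) Cℤ x ≡ (x ℕ.+ p) Cℤ x * p Cℤ j
  Cℤ-revision x p j = begin
    + ((x ℕ.+ p) choose (x ℕ.+ j)) * + ((x ℕ.+ j) choose x) ≡⟨ ℤ.pos-* ((x ℕ.+ p) choose (x ℕ.+ j)) _ ⟨
    + ((x ℕ.+ p) choose (x ℕ.+ j) ℕ.* (x ℕ.+ j) choose x)   ≡⟨ cong +_ (trinomial-revision x p j) ⟩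
    + ((x ℕ.+ p) choose x ℕ.* p choose j)                   ≡⟨ ℤ.pos-* ((x ℕ.+ p) choose x) _ ⟩
    + ((x ℕ.+ p) choose x) * + (p choose j)                 ∎

  Cℤ-exchange : ∀ b x k l → (b ℕ.+ x) Cℤ (b ℕ.+ k) * (b ℕ.+ k) Cℤ (k ℕ.+ l)
                      ≡ (b ℕ.+ x) Cℤ (x ℕ.+ l) * (l ℕ.+ x) Cℤ (l ℕ.+ k)
  Cℤ-exchange b x k l = begin
    + ((b ℕ.+ x) choose (b ℕ.+ k)) * + ((b ℕ.+ k) choose (k ℕ.+ l)) ≡⟨ ℤ.pos-* ((b ℕ.+ x) choose (b ℕ.+ k)) _ ⟨
    + ((b ℕ.+ x) choose (b ℕ.+ k) ℕ.* (b ℕ.+ k) choose (k ℕ.+ l))   ≡⟨ cong +_ (trinomial-exchange b x k l) ⟩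
    + ((b ℕ.+ x) choose (x ℕ.+ l) ℕ.* (l ℕ.+ x) choose (l ℕ.+ k))   ≡⟨ ℤ.pos-* ((b ℕ.+ x) choose (x ℕ.+ l)) _ ⟩
    + ((b ℕ.+ x) choose (x ℕ.+ l)) * + ((l ℕ.+ x) choose (l ℕ.+ k)) ∎

-- Induction on p that moves one unit from p to q: Pascal's rule splits the first factor, a shift of
-- the index aligns the two sums, and Pascal's rule for the second factor joins them again. The
-- range may be any `M` above p because later terms are 0.
vandermonde : ∀ {M} p q m → p < M → ∑[ j < M ] (p Cℤ j * q Cℤ (m ℕ.+ j)) ≡ (p ℕ.+ q) Cℤ (p ℕ.+ m)
vandermonde {suc M} zero q m _ = begin
  ∑[ j < suc M ] (0 Cℤ j * q Cℤ (m ℕ.+ j))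
    ≡⟨ ∑-truncate _ (s≤s z≤n) (λ { (suc j) _ _ → cong (_* q Cℤ (m ℕ.+ suc j)) (Cℤ-zero (s≤s z≤n)) }) ⟩
  ∑[ j < 1 ] (0 Cℤ j * q Cℤ (m ℕ.+ j))
    ≡⟨ trans (∑-last 0 _) (cong (_+ 0 Cℤ 0 * q Cℤ (m ℕ.+ 0)) (∑-empty _)) ⟩
  0ℤ + 0 Cℤ 0 * q Cℤ (m ℕ.+ 0)
    ≡⟨ cong₂ (λ y i → 0ℤ + y * q Cℤ i) (nCℤ0≡1 0) (ℕ.+-identityʳ m) ⟩
  0ℤ + 1ℤ * q Cℤ m
    ≡⟨ trans (ℤ.+-identityˡ _) (ℤ.*-identityˡ _) ⟩
  q Cℤ m ∎
vandermonde {suc M} (suc p) q m (s≤s p<M) = begin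
  ∑[ j < suc M ] (suc p Cℤ j * u j)
    ≡⟨ ∑-head M _ ⟩
  suc p Cℤ 0 * u 0 + ∑[ j < M ] (suc p Cℤ suc j * u (suc j))
    ≡⟨ cong₂ (λ y z → y * u 0 + z) (trans (nCℤ0≡1 (suc p)) (sym (nCℤ0≡1 p)))
             (∑-cong M (λ j _ → trans (cong (_* u (suc j)) (Cℤ-pascal p j)) (ℤ.*-distribʳ-+ (u (suc j)) (p Cℤ j) _))) ⟩
  p Cℤ 0 * u 0 + ∑[ j < M ] (p Cℤ j * u (suc j) + p Cℤ suc j * u (suc j))
    ≡⟨ cong (λ y → p Cℤ 0 * u 0 + y) (∑-+ M _ _) ⟩
  p Cℤ 0 * u 0 + (∑[ j < M ] (p Cℤ j * u (suc j)) + ∑[ j < M ] (p Cℤ suc j * u (suc j)))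
    ≡⟨ rearrange (p Cℤ 0 * u 0) (∑[ j < M ] (p Cℤ j * u (suc j))) _ ⟩
  ∑[ j < M ] (p Cℤ j * u (suc j)) + (p Cℤ 0 * u 0 + ∑[ j < M ] (p Cℤ suc j * u (suc j)))
    ≡⟨ cong (λ y → ∑[ j < M ] (p Cℤ j * u (suc j)) + y) (∑-head M _) ⟨
  ∑[ j < M ] (p Cℤ j * u (suc j)) + ∑[ j < suc M ] (p Cℤ j * u j)
    ≡⟨ cong (λ y → ∑[ j < M ] (p Cℤ j * u (suc j)) + y) (∑-truncate (λ j → p Cℤ j * u j) (ℕ.n≤1+n M) (λ j M≤j _ → cong (_* u j) (Cℤ-zero (ℕ.<-≤-trans p<M M≤j)))) ⟩
  ∑[ j < M ] (p Cℤ j * u (suc j)) + ∑[ j < M ] (p Cℤ j * u j)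
    ≡⟨ ∑-+ M _ _ ⟨
  ∑[ j < M ] (p Cℤ j * u (suc j) + p Cℤ j * u j)
    ≡⟨ ∑-cong M (λ j _ → merge j) ⟩
  ∑[ j < M ] (p Cℤ j * suc q Cℤ (suc m ℕ.+ j))
    ≡⟨ vandermonde p (suc q) (suc m) p<M ⟩
  (p ℕ.+ suc q) Cℤ (p ℕ.+ suc m)
    ≡⟨ cong₂ _Cℤ_ (ℕ.+-suc p q) (ℕ.+-suc p m) ⟩
  (suc p ℕ.+ q) Cℤ (suc p ℕ.+ m) ∎
  where
  u : ℕ → ℤ
  u j = q Cℤ (m ℕ.+ j)

  rearrange : ∀ a b c → a + (b + c) ≡ b + (a + c)
  rearrange = solve-∀

  merge : ∀ j → p Cℤ j * u (suc j) + p Cℤ j * u j ≡ p Cℤ j * suc q Cℤ (suc m ℕ.+ j)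
  merge j = begin
    p Cℤ j * u (suc j) + p Cℤ j * u j ≡⟨ ℤ.*-distribˡ-+ (p Cℤ j) (u (suc j)) (u j) ⟨
    p Cℤ j * (u (suc j) + u j)        ≡⟨ cong (p Cℤ j *_) (ℤ.+-comm (u (suc j)) (u j)) ⟩
    p Cℤ j * (u j + u (suc j))        ≡⟨ cong (λ i → p Cℤ j * (u j + q Cℤ i)) (ℕ.+-suc m j) ⟩
    p Cℤ j * (u j + q Cℤ suc (m ℕ.+ j)) ≡⟨ cong (p Cℤ j *_) (Cℤ-pascal q (m ℕ.+ j)) ⟨
    p Cℤ j * suc q Cℤ (suc m ℕ.+ j)   ∎

-- Trinomial revision turns the first two factors into (N + a choose N + k)(a - k choose l - k). The
-- first of these does not depend on l, and Vandermonde's identity sums the rest. The equation for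
-- `q′` says q′ = a + q - k without truncated subtraction.
revised-vandermonde : ∀ {M a} N k q q′ m → a < M → q′ ℕ.+ k ≡ a ℕ.+ q →
  ∑[ l < M ] ((N ℕ.+ a) Cℤ (N ℕ.+ l) * (N ℕ.+ l) Cℤ (N ℕ.+ k) * q Cℤ (m ℕ.+ l))
  ≡ (N ℕ.+ a) Cℤ (N ℕ.+ k) * q′ Cℤ (a ℕ.+ m)
revised-vandermonde {M} {a} N k q q′ m a<M q′+k≡a+q with k ℕ.≤? a
... | no k≰a = begin
  _ ≡⟨ ∑-zero M (λ l _ → cong (_* q Cℤ (m ℕ.+ l)) (vanish l)) ⟩
  0ℤ * q′ Cℤ (a ℕ.+ m) ≡⟨ cong (_* q′ Cℤ (a ℕ.+ m)) (Cℤ-zero (ℕ.+-monoʳ-< N (ℕ.≰⇒> k≰a))) ⟨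
  _ ∎
  where
  vanish : ∀ l → (N ℕ.+ a) Cℤ (N ℕ.+ l) * (N ℕ.+ l) Cℤ (N ℕ.+ k) ≡ 0ℤ
  vanish l with k ℕ.≤? l
  ... | yes k≤l = cong (_* (N ℕ.+ l) Cℤ (N ℕ.+ k)) (Cℤ-zero (ℕ.+-monoʳ-< N (ℕ.<-≤-trans (ℕ.≰⇒> k≰a) k≤l)))
  ... | no k≰l = trans (cong ((N ℕ.+ a) Cℤ (N ℕ.+ l) *_) (Cℤ-zero (ℕ.+-monoʳ-< N (ℕ.≰⇒> k≰l)))) (ℤ.*-zeroʳ ((N ℕ.+ a) Cℤ (N ℕ.+ l)))
-- Here p = a - k and r = M - k; the terms with l < k vanish, so the sum is restarted at l = k.
... | yes k≤a
  with p , refl ← ℕ.m≤n⇒∃[o]m+o≡n k≤a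
  with r , refl ← ℕ.m≤n⇒∃[o]m+o≡n (ℕ.<⇒≤ (ℕ.≤-<-trans k≤a a<M)) = begin
  ∑[ l < k ℕ.+ r ] (t l * (N ℕ.+ l) Cℤ x * q Cℤ (m ℕ.+ l))
    ≡⟨ ∑-shift k _ (λ l l<k → cong (_* q Cℤ (m ℕ.+ l)) (trans (cong (t l *_) (Cℤ-zero (ℕ.+-monoʳ-< N l<k))) (ℤ.*-zeroʳ (t l)))) ⟩
  ∑[ j < r ] (t (k ℕ.+ j) * (N ℕ.+ (k ℕ.+ j)) Cℤ x * q Cℤ (m ℕ.+ (k ℕ.+ j)))
    ≡⟨ ∑-cong r (λ j _ → revise j) ⟩
  ∑[ j < r ] (c * (p Cℤ j * q Cℤ (m ℕ.+ k ℕ.+ j)))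
    ≡⟨ ∑-distribˡ r c _ ⟨
  c * ∑[ j < r ] (p Cℤ j * q Cℤ (m ℕ.+ k ℕ.+ j))
    ≡⟨ cong (c *_) (vandermonde p q (m ℕ.+ k) (ℕ.+-cancelˡ-< k p r a<M)) ⟩
  c * (p ℕ.+ q) Cℤ (p ℕ.+ (m ℕ.+ k))
    ≡⟨ cong₂ (λ i j → c * i Cℤ j) q′≡p+q (index p m k) ⟨
  c * q′ Cℤ (k ℕ.+ p ℕ.+ m) ∎
  where
  x = N ℕ.+ k
  c = (N ℕ.+ (k ℕ.+ p)) Cℤ x
  t : ℕ → ℤ
  t l = (N ℕ.+ (k ℕ.+ p)) Cℤ (N ℕ.+ l)

  index : ∀ p m k → k ℕ.+ p ℕ.+ m ≡ p ℕ.+ (m ℕ.+ k)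
  index p m k = trans (cong (ℕ._+ m) (ℕ.+-comm k p)) (trans (ℕ.+-assoc p k m) (cong (p ℕ.+_) (ℕ.+-comm k m)))

  q′≡p+q : q′ ≡ p ℕ.+ q
  q′≡p+q = ℕ.+-cancelˡ-≡ k q′ (p ℕ.+ q) (trans (ℕ.+-comm k q′) (trans q′+k≡a+q (ℕ.+-assoc k p q)))

  revise : ∀ j → t (k ℕ.+ j) * (N ℕ.+ (k ℕ.+ j)) Cℤ x * q Cℤ (m ℕ.+ (k ℕ.+ j))
               ≡ c * (p Cℤ j * q Cℤ (m ℕ.+ k ℕ.+ j))
  revise j = begin
    (N ℕ.+ (k ℕ.+ p)) Cℤ (N ℕ.+ (k ℕ.+ j)) * (N ℕ.+ (k ℕ.+ j)) Cℤ x * q Cℤ (m ℕ.+ (k ℕ.+ j))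
      ≡⟨ cong₂ (λ i i′ → i Cℤ i′ * i′ Cℤ x * q Cℤ (m ℕ.+ (k ℕ.+ j))) (ℕ.+-assoc N k p) (ℕ.+-assoc N k j) ⟨
    (x ℕ.+ p) Cℤ (x ℕ.+ j) * (x ℕ.+ j) Cℤ x * q Cℤ (m ℕ.+ (k ℕ.+ j))
      ≡⟨ cong₂ (λ y i → y * q Cℤ i) (Cℤ-revision x p j) (sym (ℕ.+-assoc m k j)) ⟩
    (x ℕ.+ p) Cℤ x * p Cℤ j * q Cℤ (m ℕ.+ k ℕ.+ j)
      ≡⟨ ℤ.*-assoc ((x ℕ.+ p) Cℤ x) _ _ ⟩
    (x ℕ.+ p) Cℤ x * (p Cℤ j * q Cℤ (m ℕ.+ k ℕ.+ j))
      ≡⟨ cong (λ i → i Cℤ x * (p Cℤ j * q Cℤ (m ℕ.+ k ℕ.+ j))) (ℕ.+-assoc N k p) ⟩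
    c * (p Cℤ j * q Cℤ (m ℕ.+ k ℕ.+ j)) ∎

-- Alternating sums over a row of binomials

-- All summands are even in k, so a sum over k ∈ ℤ is folded onto k ≥ 0 with these weights.
ε : ℕ → ℤ
ε zero    = 1ℤ
ε (suc k) = + 2 * -1ℤ ^ suc k

-- Pascal's rule makes the sum telescope. The term k = 0 has weight 1 only, but the central binomial
-- of row 2l + 2 is itself twice an entry of row 2l + 1, so it fits the doubled weights of the other
-- terms.
alternating-partial-sum : ∀ l K → let n = l ℕ.+ suc l in
  ∑[ k < suc K ] (ε k * suc n Cℤ (suc l ℕ.+ k)) ≡ + 2 * -1ℤ ^ K * n Cℤ (l ℕ.+ suc K)
alternating-partial-sum l zero = begin
  ∑[ k < 1 ] (ε k * suc n Cℤ (suc l ℕ.+ k))          ≡⟨ ∑-last 0 _ ⟩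
  ∑ 0 _ + 1ℤ * suc n Cℤ (suc l ℕ.+ 0)                ≡⟨ cong₂ (λ y z → y + 1ℤ * z) (∑-empty _) (Cℤ-pascal n (l ℕ.+ 0)) ⟩
  0ℤ + 1ℤ * (n Cℤ (l ℕ.+ 0) + n Cℤ suc (l ℕ.+ 0))    ≡⟨ cong₂ (λ y z → 0ℤ + 1ℤ * (y + n Cℤ z)) (trans (cong (n Cℤ_) (ℕ.+-identityʳ l)) (trans (Cℤ-sym l (suc l)) (cong (n Cℤ_) (ℕ.+-comm 1 l)))) (sym (ℕ.+-suc l 0)) ⟩
  0ℤ + 1ℤ * (n Cℤ (l ℕ.+ 1) + n Cℤ (l ℕ.+ 1))        ≡⟨ double _ ⟩
  + 2 * 1ℤ * n Cℤ (l ℕ.+ 1)                          ∎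
  where
  n = l ℕ.+ suc l

  double : ∀ x → 0ℤ + 1ℤ * (x + x) ≡ + 2 * 1ℤ * x
  double = solve-∀
alternating-partial-sum l (suc K) = begin
  ∑[ k < suc (suc K) ] (ε k * suc n Cℤ (suc l ℕ.+ k))
    ≡⟨ ∑-last (suc K) _ ⟩
  ∑[ k < suc K ] (ε k * suc n Cℤ (suc l ℕ.+ k)) + ε (suc K) * suc n Cℤ (suc l ℕ.+ suc K)
    ≡⟨ cong₂ (λ y z → y + ε (suc K) * z) (alternating-partial-sum l K) (Cℤ-pascal n (l ℕ.+ suc K)) ⟩
  + 2 * -1ℤ ^ K * D + + 2 * (-1ℤ * -1ℤ ^ K) * (D + n Cℤ suc (l ℕ.+ suc K))
    ≡⟨ telescope (-1ℤ ^ K) D _ ⟩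
  + 2 * (-1ℤ * -1ℤ ^ K) * n Cℤ suc (l ℕ.+ suc K)
    ≡⟨ cong (λ i → + 2 * (-1ℤ * -1ℤ ^ K) * n Cℤ i) (ℕ.+-suc l (suc K)) ⟨
  + 2 * (-1ℤ * -1ℤ ^ K) * n Cℤ (l ℕ.+ suc (suc K)) ∎
  where
  n = l ℕ.+ suc l
  D = n Cℤ (l ℕ.+ suc K)

  telescope : ∀ s x y → + 2 * s * x + + 2 * (-1ℤ * s) * (x + y) ≡ + 2 * (-1ℤ * s) * y
  telescope = solve-∀

-- This is (1 - 1)^(2l) = 0 in folded form: once the range exceeds l, the closed form of the partial
-- sum contains a binomial that vanishes.
alternating-sum : ∀ {M} l → l < M → l ≢ 0 → ∑[ k < M ] (ε k * (l ℕ.+ l) Cℤ (l ℕ.+ k)) ≡ 0ℤ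
alternating-sum zero    _           l≢0 with () ← l≢0 refl
alternating-sum {suc K} (suc l) (s≤s l<K) _ = begin
  _                                             ≡⟨ alternating-partial-sum l K ⟩
  + 2 * -1ℤ ^ K * (l ℕ.+ suc l) Cℤ (l ℕ.+ suc K) ≡⟨ cong (+ 2 * -1ℤ ^ K *_) (Cℤ-zero (ℕ.+-monoʳ-< l (s≤s l<K))) ⟩
  + 2 * -1ℤ ^ K * 0ℤ                            ≡⟨ ℤ.*-zeroʳ (+ 2 * -1ℤ ^ K) ⟩
  0ℤ                                            ∎

alternating-sum-0 : ∀ {M} → 0 < M → ∑[ k < M ] (ε k * 0 Cℤ k) ≡ 1ℤ
alternating-sum-0 {M} 0<M = begin
  ∑[ k < M ] (ε k * 0 Cℤ k)  ≡⟨ ∑-truncate _ 0<M (λ k 0<k _ → trans (cong (ε k *_) (Cℤ-zero 0<k)) (ℤ.*-zeroʳ (ε k))) ⟩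
  ∑[ k < 1 ] (ε k * 0 Cℤ k)  ≡⟨ ∑-last 0 _ ⟩
  ∑ 0 _ + 1ℤ * 0 Cℤ 0        ≡⟨ cong₂ (λ y z → y + 1ℤ * z) (∑-empty _) (nCℤ0≡1 0) ⟩
  1ℤ                         ∎

-- Cyclic products and their alternating sums

next : List ℕ → ℕ → ℕ
next []      N = N
next (b ∷ _) N = b

-- A cycle a, b₁, …, bᵣ, N is represented by a, the list bs and N. Its summand is the
-- product of binomials (x + y choose x + k) over the edges (x, y); `pathProduct` leaves out
-- the closing edge (N, a).
links : List ℕ → ℕ → ℕ → ℤ
links []       N k = 1ℤ
links (b ∷ bs) N k = (b ℕ.+ next bs N) Cℤ (b ℕ.+ k) * links bs N k

pathProduct : ℕ → List ℕ → ℕ → ℕ → ℤ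
pathProduct a bs N k = links (a ∷ bs) N k

-- M only has to exceed a: the terms with l > a vanish.
chain : ℕ → ℕ → ℕ → List ℕ → ℤ
chain M N a []       = 1ℤ
chain M N a (b ∷ bs) =
  ∑[ l < M ] (a Cℤ l * (b ℕ.+ next bs N) Cℤ (next bs N ℕ.+ l) * chain M N l bs)

-- The reduction step: the neighbours a, b in the cycle are merged into one new vertex l, at the
-- price of a sum over l whose weights are free of k. `revised-vandermonde` read backwards expands
-- the edges (N, a) and (a, b); the leftover factor (b + k choose k + l) is exchanged with the edge
-- (b, x).
expand : ∀ {M a} N b x k → a < M →
  (a ℕ.+ b) Cℤ (a ℕ.+ k) * (b ℕ.+ x) Cℤ (b ℕ.+ k) * (N ℕ.+ a) Cℤ (N ℕ.+ k)
  ≡ ∑[ l < M ] ((N ℕ.+ a) Cℤ (N ℕ.+ l) * (b ℕ.+ x) Cℤ (x ℕ.+ l)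
                * ((l ℕ.+ x) Cℤ (l ℕ.+ k) * (N ℕ.+ l) Cℤ (N ℕ.+ k)))
expand {M} {a} N b x k a<M = begin
  (a ℕ.+ b) Cℤ (a ℕ.+ k) * y * (N ℕ.+ a) Cℤ (N ℕ.+ k)
    ≡⟨ rotate ((a ℕ.+ b) Cℤ (a ℕ.+ k)) y _ ⟩
  y * ((N ℕ.+ a) Cℤ (N ℕ.+ k) * (a ℕ.+ b) Cℤ (a ℕ.+ k))
    ≡⟨ cong (y *_) (revised-vandermonde N k (b ℕ.+ k) (a ℕ.+ b) k a<M (ℕ.+-assoc a b k)) ⟨
  y * ∑[ l < M ] ((N ℕ.+ a) Cℤ (N ℕ.+ l) * (N ℕ.+ l) Cℤ (N ℕ.+ k) * (b ℕ.+ k) Cℤ (k ℕ.+ l))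
    ≡⟨ ∑-distribˡ M y _ ⟩
  ∑[ l < M ] (y * ((N ℕ.+ a) Cℤ (N ℕ.+ l) * (N ℕ.+ l) Cℤ (N ℕ.+ k) * (b ℕ.+ k) Cℤ (k ℕ.+ l)))
    ≡⟨ ∑-cong M (λ l _ → swap l) ⟩
  _ ∎
  where
  y = (b ℕ.+ x) Cℤ (b ℕ.+ k)

  rotate : ∀ p q r → p * q * r ≡ q * (r * p)
  rotate = solve-∀

  group : ∀ p q r s → p * (q * r * s) ≡ q * (p * s) * r
  group = solve-∀

  regroup : ∀ p q r s → p * (q * r) * s ≡ p * q * (r * s)
  regroup = solve-∀

  swap : ∀ l → y * ((N ℕ.+ a) Cℤ (N ℕ.+ l) * (N ℕ.+ l) Cℤ (N ℕ.+ k) * (b ℕ.+ k) Cℤ (k ℕ.+ l))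
             ≡ (N ℕ.+ a) Cℤ (N ℕ.+ l) * (b ℕ.+ x) Cℤ (x ℕ.+ l)
               * ((l ℕ.+ x) Cℤ (l ℕ.+ k) * (N ℕ.+ l) Cℤ (N ℕ.+ k))
  swap l = begin
    y * (u * v * (b ℕ.+ k) Cℤ (k ℕ.+ l))                            ≡⟨ group y u v _ ⟩
    u * (y * (b ℕ.+ k) Cℤ (k ℕ.+ l)) * v                            ≡⟨ cong (λ z → u * z * v) (Cℤ-exchange b x k l) ⟩
    u * ((b ℕ.+ x) Cℤ (x ℕ.+ l) * (l ℕ.+ x) Cℤ (l ℕ.+ k)) * v       ≡⟨ regroup u _ _ v ⟩
    u * (b ℕ.+ x) Cℤ (x ℕ.+ l) * ((l ℕ.+ x) Cℤ (l ℕ.+ k) * v)       ∎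
    where
    u = (N ℕ.+ a) Cℤ (N ℕ.+ l)
    v = (N ℕ.+ l) Cℤ (N ℕ.+ k)

weighted-expand : ∀ {M} (w f : ℕ → ℤ) (u : ℕ → ℤ) (v : ℕ → ℕ → ℤ) →
  (∀ k → f k ≡ ∑[ l < M ] (u l * v l k)) →
  ∑[ k < M ] (w k * f k) ≡ ∑[ l < M ] (u l * ∑[ k < M ] (w k * v l k))
weighted-expand {M} w f u v f≗ = begin
  ∑[ k < M ] (w k * f k)
    ≡⟨ ∑-cong M (λ k _ → trans (cong (w k *_) (f≗ k)) (∑-distribˡ M (w k) _)) ⟩
  ∑[ k < M ] ∑[ l < M ] (w k * (u l * v l k))
    ≡⟨ ∑-swap M M _ ⟩
  ∑[ l < M ] ∑[ k < M ] (w k * (u l * v l k))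
    ≡⟨ ∑-cong M (λ l _ → trans (∑-cong M (λ k _ → pull (w k) (u l) (v l k))) (sym (∑-distribˡ M (u l) _))) ⟩
  ∑[ l < M ] (u l * ∑[ k < M ] (w k * v l k)) ∎
  where
  pull : ∀ p q r → p * (q * r) ≡ q * (p * r)
  pull = solve-∀

-- Induction on the length of the cycle. `expand` shortens it, the induction hypothesis is applied
-- with l in place of a, and trinomial revision extracts the common factor (N + a choose N) from all
-- the terms.
cyclic-sum : ∀ {M} a bs N → a < M →
  ∑[ k < M ] (ε k * (pathProduct a bs N k * (N ℕ.+ a) Cℤ (N ℕ.+ k)))
  ≡ (N ℕ.+ a) Cℤ N * chain M N a bs
cyclic-sum {M} a [] N a<M = begin
  ∑[ k < M ] (ε k * ((a ℕ.+ N) Cℤ (a ℕ.+ k) * 1ℤ * (N ℕ.+ a) Cℤ (N ℕ.+ k)))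
    ≡⟨ weighted-expand ε _ u v expand′ ⟩
  ∑[ l < M ] (u l * ∑[ k < M ] (ε k * v l k))
    -- For a cycle of length two the inner sum runs over row 2l alone, so it is 0 for l > 0 and 1
    -- for l = 0.
    ≡⟨ ∑-truncate _ (ℕ.≤-<-trans z≤n a<M) vanish ⟩
  ∑[ l < 1 ] (u l * ∑[ k < M ] (ε k * v l k))
    ≡⟨ trans (∑-last 0 _) (cong₂ (λ y z → y + u 0 * z) (∑-empty _) (alternating-sum-0 (ℕ.≤-<-trans z≤n a<M))) ⟩
  0ℤ + u 0 * 1ℤ
    ≡⟨ trans (ℤ.+-identityˡ _) (ℤ.*-identityʳ _) ⟩
  (N ℕ.+ a) Cℤ (N ℕ.+ 0) * (N ℕ.+ 0) Cℤ 0
    ≡⟨ cong₂ (λ i y → (N ℕ.+ a) Cℤ i * y) (ℕ.+-identityʳ N) (nCℤ0≡1 (N ℕ.+ 0)) ⟩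
  (N ℕ.+ a) Cℤ N * 1ℤ ∎
  where
  u : ℕ → ℤ
  u l = (N ℕ.+ a) Cℤ (N ℕ.+ l) * (N ℕ.+ l) Cℤ (l ℕ.+ l)
  v : ℕ → ℕ → ℤ
  v l k = (l ℕ.+ l) Cℤ (l ℕ.+ k)

  swap : ∀ k l → (N ℕ.+ a) Cℤ (N ℕ.+ l) * (N ℕ.+ l) Cℤ (N ℕ.+ k) * (N ℕ.+ k) Cℤ (k ℕ.+ l) ≡ u l * v l k
  swap k l = begin
    c * (N ℕ.+ l) Cℤ (N ℕ.+ k) * (N ℕ.+ k) Cℤ (k ℕ.+ l)    ≡⟨ ℤ.*-assoc c _ _ ⟩
    c * ((N ℕ.+ l) Cℤ (N ℕ.+ k) * (N ℕ.+ k) Cℤ (k ℕ.+ l))  ≡⟨ cong (c *_) (Cℤ-exchange N l k l) ⟩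
    c * ((N ℕ.+ l) Cℤ (l ℕ.+ l) * (l ℕ.+ l) Cℤ (l ℕ.+ k))  ≡⟨ ℤ.*-assoc c _ _ ⟨
    u l * v l k                                            ∎
    where c = (N ℕ.+ a) Cℤ (N ℕ.+ l)

  expand′ : ∀ k → (a ℕ.+ N) Cℤ (a ℕ.+ k) * 1ℤ * (N ℕ.+ a) Cℤ (N ℕ.+ k) ≡ ∑[ l < M ] (u l * v l k)
  expand′ k = begin
    (a ℕ.+ N) Cℤ (a ℕ.+ k) * 1ℤ * (N ℕ.+ a) Cℤ (N ℕ.+ k)
      ≡⟨ cong (_* (N ℕ.+ a) Cℤ (N ℕ.+ k)) (ℤ.*-identityʳ ((a ℕ.+ N) Cℤ (a ℕ.+ k))) ⟩
    (a ℕ.+ N) Cℤ (a ℕ.+ k) * (N ℕ.+ a) Cℤ (N ℕ.+ k)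
      ≡⟨ ℤ.*-comm ((a ℕ.+ N) Cℤ (a ℕ.+ k)) _ ⟩
    (N ℕ.+ a) Cℤ (N ℕ.+ k) * (a ℕ.+ N) Cℤ (a ℕ.+ k)
      ≡⟨ revised-vandermonde N k (N ℕ.+ k) (a ℕ.+ N) k a<M (ℕ.+-assoc a N k) ⟨
    ∑[ l < M ] ((N ℕ.+ a) Cℤ (N ℕ.+ l) * (N ℕ.+ l) Cℤ (N ℕ.+ k) * (N ℕ.+ k) Cℤ (k ℕ.+ l))
      ≡⟨ ∑-cong M (λ l _ → swap k l) ⟩
    ∑[ l < M ] (u l * v l k) ∎

  vanish : ∀ l → 1 ≤ l → l < M → u l * ∑[ k < M ] (ε k * v l k) ≡ 0ℤ
  vanish l 1≤l l<M = trans (cong (λ y → u l * y) (alternating-sum l l<M (ℕ.m<n⇒n≢0 1≤l))) (ℤ.*-zeroʳ (u l))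
cyclic-sum {M} a (b ∷ bs) N a<M = begin
  ∑[ k < M ] (ε k * (pathProduct a (b ∷ bs) N k * (N ℕ.+ a) Cℤ (N ℕ.+ k)))
    ≡⟨ weighted-expand ε _ u v expand′ ⟩
  ∑[ l < M ] (u l * ∑[ k < M ] (ε k * v l k))
    ≡⟨ ∑-cong M (λ l l<M → cong (u l *_) (cyclic-sum l bs N l<M)) ⟩
  ∑[ l < M ] (u l * ((N ℕ.+ l) Cℤ N * chain M N l bs))
    ≡⟨ ∑-cong M (λ l _ → revise l) ⟩
  ∑[ l < M ] (c * (a Cℤ l * (b ℕ.+ x) Cℤ (x ℕ.+ l) * chain M N l bs))
    ≡⟨ ∑-distribˡ M c _ ⟨
  c * chain M N a (b ∷ bs) ∎
  where
  x = next bs N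
  c = (N ℕ.+ a) Cℤ N
  u : ℕ → ℤ
  u l = (N ℕ.+ a) Cℤ (N ℕ.+ l) * (b ℕ.+ x) Cℤ (x ℕ.+ l)
  v : ℕ → ℕ → ℤ
  v l k = pathProduct l bs N k * (N ℕ.+ l) Cℤ (N ℕ.+ k)

  split : ∀ p q r s → p * (q * r) * s ≡ p * q * s * r
  split = solve-∀

  merge : ∀ p q r s → p * (q * r) * s ≡ p * (q * s * r)
  merge = solve-∀

  expand′ : ∀ k → pathProduct a (b ∷ bs) N k * (N ℕ.+ a) Cℤ (N ℕ.+ k) ≡ ∑[ l < M ] (u l * v l k)
  expand′ k = begin
    (a ℕ.+ b) Cℤ (a ℕ.+ k) * ((b ℕ.+ x) Cℤ (b ℕ.+ k) * links bs N k) * (N ℕ.+ a) Cℤ (N ℕ.+ k)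
      ≡⟨ split ((a ℕ.+ b) Cℤ (a ℕ.+ k)) _ _ _ ⟩
    (a ℕ.+ b) Cℤ (a ℕ.+ k) * (b ℕ.+ x) Cℤ (b ℕ.+ k) * (N ℕ.+ a) Cℤ (N ℕ.+ k) * links bs N k
      ≡⟨ cong (_* links bs N k) (expand N b x k a<M) ⟩
    ∑[ l < M ] (u l * ((l ℕ.+ x) Cℤ (l ℕ.+ k) * (N ℕ.+ l) Cℤ (N ℕ.+ k))) * links bs N k
      ≡⟨ ∑-distribʳ M (links bs N k) _ ⟩
    ∑[ l < M ] (u l * ((l ℕ.+ x) Cℤ (l ℕ.+ k) * (N ℕ.+ l) Cℤ (N ℕ.+ k)) * links bs N k)
      ≡⟨ ∑-cong M (λ l _ → merge (u l) ((l ℕ.+ x) Cℤ (l ℕ.+ k)) ((N ℕ.+ l) Cℤ (N ℕ.+ k)) _) ⟩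
    ∑[ l < M ] (u l * v l k) ∎

  gather : ∀ p q r s → p * q * (r * s) ≡ p * r * (q * s)
  gather = solve-∀

  ungather : ∀ p q r s → p * q * (r * s) ≡ p * (q * r * s)
  ungather = solve-∀

  revise : ∀ l → u l * ((N ℕ.+ l) Cℤ N * chain M N l bs)
               ≡ c * (a Cℤ l * (b ℕ.+ x) Cℤ (x ℕ.+ l) * chain M N l bs)
  revise l = begin
    u l * ((N ℕ.+ l) Cℤ N * chain M N l bs)
      ≡⟨ gather ((N ℕ.+ a) Cℤ (N ℕ.+ l)) ((b ℕ.+ x) Cℤ (x ℕ.+ l)) _ _ ⟩
    (N ℕ.+ a) Cℤ (N ℕ.+ l) * (N ℕ.+ l) Cℤ N * ((b ℕ.+ x) Cℤ (x ℕ.+ l) * chain M N l bs)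
      ≡⟨ cong (_* ((b ℕ.+ x) Cℤ (x ℕ.+ l) * chain M N l bs)) (Cℤ-revision N a l) ⟩
    c * a Cℤ l * ((b ℕ.+ x) Cℤ (x ℕ.+ l) * chain M N l bs)
      ≡⟨ ungather c (a Cℤ l) _ _ ⟩
    c * (a Cℤ l * (b ℕ.+ x) Cℤ (x ℕ.+ l) * chain M N l bs) ∎

-- Divisibility of chains by a prime

∣-choose⇒∣-Cℤ : ∀ {d n k} → d ℕ.∣ n choose k → + d ∣ n Cℤ k
∣-choose⇒∣-Cℤ {d} {n} {k} d∣nCk = subst (+ d ∣_) (sym (Cℤ≡choose n k)) (∣ᵤ⇒∣ d∣nCk)

-- If the prime power q divides the starting point of a chain, then modulo p only indices l
-- divisible by q contribute, and an edge (b, c) with q ∣ b + c and q ∤ c kills all of them.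
Obstructed : ℕ → List ℕ → ℕ → Set
Obstructed q []       N = ⊥
Obstructed q (b ∷ bs) N = (q ℕ.∣ b ℕ.+ next bs N × ¬ q ℕ.∣ next bs N) ⊎ Obstructed q bs N

-- In each term either p divides (a choose l), or q ∣ l and l is a starting point of the same kind
-- for the shorter chain. At the obstructing edge q ∣ l excludes q ∣ x + l, so there p divides the
-- edge's binomial.
chain-∣ : ∀ {p} → Prime p → ∀ f {M N} a bs → Obstructed (p ℕ.^ f) bs N → p ℕ.^ f ℕ.∣ a → + p ∣ chain M N a bs
chain-∣ {p} pr f {M} {N} a (b ∷ bs) obstructed q∣a = ∑-∣ M term
  where
  x = next bs N

  through : ∀ l → p ℕ.^ f ℕ.∣ l → Obstructed (p ℕ.^ f) (b ∷ bs) N →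
            + p ∣ a Cℤ l * (b ℕ.+ x) Cℤ (x ℕ.+ l) * chain M N l bs
  through l q∣l (inj₂ later) = ∣n⇒∣m*n (a Cℤ l * (b ℕ.+ x) Cℤ (x ℕ.+ l)) (chain-∣ pr f l bs later q∣l)
  through l q∣l (inj₁ (q∣b+x , q∤x)) with prime-power-∣-choose pr f (b ℕ.+ x) (x ℕ.+ l) q∣b+x
  ... | inj₁ p∣C = ∣m⇒∣m*n (chain M N l bs) (∣n⇒∣m*n (a Cℤ l) (∣-choose⇒∣-Cℤ p∣C))
  ... | inj₂ q∣x+l with () ← q∤x (ℕ.∣m+n∣m⇒∣n (subst (p ℕ.^ f ℕ.∣_) (ℕ.+-comm x l) q∣x+l) q∣l)

  term : ∀ l → + p ∣ a Cℤ l * (b ℕ.+ x) Cℤ (x ℕ.+ l) * chain M N l bs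
  term l with prime-power-∣-choose pr f a l q∣a
  ... | inj₁ p∣C = ∣m⇒∣m*n (chain M N l bs) (∣m⇒∣m*n ((b ℕ.+ x) Cℤ (x ℕ.+ l)) (∣-choose⇒∣-Cℤ p∣C))
  ... | inj₂ q∣l = through l q∣l obstructed

-- Makes the first index the inner one, so that its sum can be evaluated by `revised-vandermonde`.
chain-two-steps : ∀ {M} a b c bs N → let y = next bs N in
  chain M N a (b ∷ c ∷ bs)
  ≡ ∑[ j < M ] (∑[ l < M ] (a Cℤ l * l Cℤ j * (b ℕ.+ c) Cℤ (c ℕ.+ l))
                * ((c ℕ.+ y) Cℤ (y ℕ.+ j) * chain M N j bs))
chain-two-steps {M} a b c bs N = begin
  ∑[ l < M ] (a Cℤ l * u l * ∑[ j < M ] (l Cℤ j * (c ℕ.+ y) Cℤ (y ℕ.+ j) * chain M N j bs))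
    ≡⟨ ∑-cong M (λ l _ → ∑-distribˡ M (a Cℤ l * u l) _) ⟩
  ∑[ l < M ] ∑[ j < M ] (a Cℤ l * u l * (l Cℤ j * (c ℕ.+ y) Cℤ (y ℕ.+ j) * chain M N j bs))
    ≡⟨ ∑-swap M M _ ⟩
  ∑[ j < M ] ∑[ l < M ] (a Cℤ l * u l * (l Cℤ j * (c ℕ.+ y) Cℤ (y ℕ.+ j) * chain M N j bs))
    ≡⟨ ∑-cong M (λ j _ → trans (∑-cong M (λ l _ → regroup (a Cℤ l) (u l) (l Cℤ j) _ _)) (sym (∑-distribʳ M _ _))) ⟩
  ∑[ j < M ] (∑[ l < M ] (a Cℤ l * l Cℤ j * u l) * ((c ℕ.+ y) Cℤ (y ℕ.+ j) * chain M N j bs)) ∎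
  where
  y = next bs N
  u : ℕ → ℤ
  u l = (b ℕ.+ c) Cℤ (c ℕ.+ l)

  regroup : ∀ p q r s t → p * q * (r * s * t) ≡ p * r * q * (s * t)
  regroup = solve-∀

-- The case 8n with s = t = 1, where the cycle is 2n, n, 4n, ..., 4n. The inner sum is (2n choose
-- j)(7n - j choose 6n), the next edge contributes (8n choose 4n + j), and `even-among` finds an
-- even factor among these three.
chain-even : ∀ {M} n bs → n ≢ 0 → 2 ℕ.* n < M → next bs (4 ℕ.* n) ≡ 4 ℕ.* n →
  + 2 ∣ chain M (4 ℕ.* n) (2 ℕ.* n) (n ∷ 4 ℕ.* n ∷ bs)
chain-even {M} n bs n≢0 2n<M y≡4n =
  subst (+ 2 ∣_) (sym (chain-two-steps (2 ℕ.* n) n (4 ℕ.* n) bs (4 ℕ.* n))) (∑-∣ M term)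
  where
  y = next bs (4 ℕ.* n)
  rest : ℕ → ℤ
  rest j = chain M (4 ℕ.* n) j bs
  sum′ : ℕ → ℤ
  sum′ j = ∑[ l < M ] ((2 ℕ.* n) Cℤ l * l Cℤ j * (n ℕ.+ 4 ℕ.* n) Cℤ (4 ℕ.* n ℕ.+ l))

  4n+y≡8n : 4 ℕ.* n ℕ.+ y ≡ 8 ℕ.* n
  4n+y≡8n = trans (cong (4 ℕ.* n ℕ.+_) y≡4n) (sym (ℕ.*-distribʳ-+ n 4 4))

  7n : 2 ℕ.* n ℕ.+ (n ℕ.+ 4 ℕ.* n) ≡ 7 ℕ.* n
  7n = sym (ℕ.*-distribʳ-+ n 2 5)

  sum′≡ : ∀ j m → m ℕ.+ j ≡ 7 ℕ.* n → sum′ j ≡ (2 ℕ.* n) Cℤ j * m Cℤ (6 ℕ.* n)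
  sum′≡ j m m+j≡7n = trans
    (revised-vandermonde 0 j (n ℕ.+ 4 ℕ.* n) m (4 ℕ.* n) 2n<M (trans m+j≡7n (sym 7n)))
    (cong (λ i → (2 ℕ.* n) Cℤ j * m Cℤ i) (sym (ℕ.*-distribʳ-+ n 2 4)))

  last-even : ∀ j → 2 ℕ.∣ (8 ℕ.* n) choose (4 ℕ.* n ℕ.+ j) → + 2 ∣ (4 ℕ.* n ℕ.+ y) Cℤ (y ℕ.+ j)
  last-even j 2∣C = subst₂ (λ s t → + 2 ∣ s Cℤ (t ℕ.+ j)) (sym 4n+y≡8n) (sym y≡4n) (∣-choose⇒∣-Cℤ 2∣C)

  term : ∀ j → + 2 ∣ sum′ j * ((4 ℕ.* n ℕ.+ y) Cℤ (y ℕ.+ j) * rest j)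
  -- The closed form needs 7n - j as a natural number; for j > 7n the last binomial is 0 already.
  term j with j ℕ.≤? 7 ℕ.* n
  ... | no j≰7n = ∣n⇒∣m*n (sum′ j) (∣m⇒∣m*n (rest j) (last-even j
          (subst (2 ℕ.∣_) (sym (k>n⇒nchoosek≡0 8n<4n+j)) (2 ℕ.∣0))))
    where
    8n<4n+j : 8 ℕ.* n < 4 ℕ.* n ℕ.+ j
    8n<4n+j = subst (_< 4 ℕ.* n ℕ.+ j) (sym (ℕ.*-distribʳ-+ n 4 4))
      (ℕ.+-monoʳ-< (4 ℕ.* n) (ℕ.≤-<-trans (ℕ.*-monoˡ-≤ n (ℕ.m≤m+n 4 3)) (ℕ.≰⇒> j≰7n)))
  ... | yes j≤7n with m , j+m≡7n ← ℕ.m≤n⇒∃[o]m+o≡n j≤7n = by (even-among n j m n≢0 m+j≡7n)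
    where
    m+j≡7n : m ℕ.+ j ≡ 7 ℕ.* n
    m+j≡7n = trans (ℕ.+-comm m j) j+m≡7n

    first-even : + 2 ∣ (2 ℕ.* n) Cℤ j * m Cℤ (6 ℕ.* n) → + 2 ∣ sum′ j * ((4 ℕ.* n ℕ.+ y) Cℤ (y ℕ.+ j) * rest j)
    first-even 2∣ = ∣m⇒∣m*n _ (subst (+ 2 ∣_) (sym (sum′≡ j m m+j≡7n)) 2∣)

    by : Even-among n j m → + 2 ∣ sum′ j * ((4 ℕ.* n ℕ.+ y) Cℤ (y ℕ.+ j) * rest j)
    by (even₁ 2∣C) = first-even (∣m⇒∣m*n (m Cℤ (6 ℕ.* n)) (∣-choose⇒∣-Cℤ 2∣C))
    by (even₂ 2∣C) = first-even (∣n⇒∣m*n ((2 ℕ.* n) Cℤ j) (∣-choose⇒∣-Cℤ 2∣C))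
    by (even₃ 2∣C) = ∣n⇒∣m*n (sum′ j) (∣m⇒∣m*n (rest j) (last-even j 2∣C))

-- From central binomials to cyclic products

module _ (A B D k : ℕ) where
  private
    bA = (A ℕ.+ A) choose (A ℕ.+ k)
    bB = (B ℕ.+ B) choose (B ℕ.+ k)
    bD = (D ℕ.+ D) choose (D ℕ.+ k)
    bAB = (A ℕ.+ B) choose (A ℕ.+ k)
    bBD = (B ℕ.+ D) choose (B ℕ.+ k)
    bDA = (D ℕ.+ A) choose (D ℕ.+ k)

    vanish : ∀ m {n} → n < k → (m ℕ.+ n) choose (m ℕ.+ k) ≡ 0
    vanish m n<k = k>n⇒nchoosek≡0 (ℕ.+-monoʳ-< m n<k)

    choose-∸ : ∀ m {n} → k ≤ n →
      (m ℕ.+ n) choose (m ℕ.+ k) ℕ.* ((m ℕ.+ k) ! ℕ.* (n ℕ.∸ k) !) ≡ (m ℕ.+ n) !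
    choose-∸ m {n} k≤n = subst (λ i → i choose (m ℕ.+ k) ℕ.* ((m ℕ.+ k) ! ℕ.* (n ℕ.∸ k) !) ≡ i !)
      (trans (ℕ.+-assoc m k (n ℕ.∸ k)) (cong (m ℕ.+_) (ℕ.m+[n∸m]≡n k≤n))) (choose-! (m ℕ.+ k) (n ℕ.∸ k))

    shuffle : ∀ a b d ab bd da x y z u v w →
      ab ℕ.* (x ℕ.* v) ℕ.* (bd ℕ.* (y ℕ.* w)) ℕ.* (da ℕ.* (z ℕ.* u)) ℕ.* (a ℕ.* b ℕ.* d)
      ≡ a ℕ.* (x ℕ.* u) ℕ.* (b ℕ.* (y ℕ.* v)) ℕ.* (d ℕ.* (z ℕ.* w)) ℕ.* (ab ℕ.* bd ℕ.* da)
    shuffle = ℕ-Solver.solve-∀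

  -- Both products of binomials have the same denominators, the factorials of A ± k, B ± k and D ±
  -- k, which are only paired differently; the numerators are the factorials on the opposite sides.
  -- If k exceeds A, B or D, both products contain a zero.
  central-to-cyclic :
    (A ℕ.+ B) ! ℕ.* (B ℕ.+ D) ! ℕ.* (D ℕ.+ A) ! ℕ.* (bA ℕ.* bB ℕ.* bD)
    ≡ (A ℕ.+ A) ! ℕ.* (B ℕ.+ B) ! ℕ.* (D ℕ.+ D) ! ℕ.* (bAB ℕ.* bBD ℕ.* bDA)
  central-to-cyclic with k ℕ.≤? A | k ℕ.≤? B | k ℕ.≤? D
  ... | no k≰A | _ | _
    rewrite vanish A (ℕ.≰⇒> k≰A) | vanish D (ℕ.≰⇒> k≰A) | ℕ.*-zeroʳ (bAB ℕ.* bBD)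
    = trans (ℕ.*-zeroʳ ((A ℕ.+ B) ! ℕ.* (B ℕ.+ D) ! ℕ.* (D ℕ.+ A) !)) (sym (ℕ.*-zeroʳ ((A ℕ.+ A) ! ℕ.* (B ℕ.+ B) ! ℕ.* (D ℕ.+ D) !)))
  ... | yes _ | no k≰B | _
    rewrite vanish A (ℕ.≰⇒> k≰B) | vanish B (ℕ.≰⇒> k≰B) | ℕ.*-zeroʳ bA
    = trans (ℕ.*-zeroʳ ((A ℕ.+ B) ! ℕ.* (B ℕ.+ D) ! ℕ.* (D ℕ.+ A) !)) (sym (ℕ.*-zeroʳ ((A ℕ.+ A) ! ℕ.* (B ℕ.+ B) ! ℕ.* (D ℕ.+ D) !)))
  ... | yes _ | yes _ | no k≰D
    rewrite vanish B (ℕ.≰⇒> k≰D) | vanish D (ℕ.≰⇒> k≰D) | ℕ.*-zeroʳ (bA ℕ.* bB) | ℕ.*-zeroʳ bAB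
    = trans (ℕ.*-zeroʳ ((A ℕ.+ B) ! ℕ.* (B ℕ.+ D) ! ℕ.* (D ℕ.+ A) !)) (sym (ℕ.*-zeroʳ ((A ℕ.+ A) ! ℕ.* (B ℕ.+ B) ! ℕ.* (D ℕ.+ D) !)))
  ... | yes k≤A | yes k≤B | yes k≤D
    rewrite sym (choose-∸ A k≤A) | sym (choose-∸ B k≤B) | sym (choose-∸ D k≤D)
          | sym (choose-∸ A k≤B) | sym (choose-∸ B k≤D) | sym (choose-∸ D k≤A)
    = shuffle bA bB bD bAB bBD bDA ((A ℕ.+ k) !) ((B ℕ.+ k) !) ((D ℕ.+ k) !) ((A ℕ.∸ k) !) ((B ℕ.∸ k) !) ((D ℕ.∸ k) !)

next-replicate : ∀ t D → next (replicate t D) D ≡ D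
next-replicate zero    D = refl
next-replicate (suc t) D = refl

links-replicate : ∀ t D k → links (replicate t D) D k ≡ (D ℕ.+ D) Cℤ (D ℕ.+ k) ^ t
links-replicate zero    D k = refl
links-replicate (suc t) D k =
  cong₂ (λ x y → (D ℕ.+ x) Cℤ (D ℕ.+ k) * y) (next-replicate t D) (links-replicate t D k)

-- Each repetition of A adds a loop (A, A) to the cycle, and a loop is a central binomial; this is
-- how powers enter.
links-repeat : ∀ s A bs N k →
  links (A ∷ (replicate s A ++ bs)) N k ≡ (A ℕ.+ A) Cℤ (A ℕ.+ k) ^ s * links (A ∷ bs) N k
links-repeat zero    A bs N k = sym (ℤ.*-identityˡ _)
links-repeat (suc s) A bs N k =
  trans (cong ((A ℕ.+ A) Cℤ (A ℕ.+ k) *_) (links-repeat s A bs N k))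
        (sym (ℤ.*-assoc ((A ℕ.+ A) Cℤ (A ℕ.+ k)) _ _))

-- In the cycle that starts at A and ends at D, the block sizes are s + 1, r + 1 and t + 1.
blocks : (A B D s r t : ℕ) → List ℕ
blocks A B D s r t = replicate s A ++ B ∷ (replicate r B ++ replicate t D)

pathProduct-blocks : ∀ A B D s r t k →
  pathProduct A (blocks A B D s r t) D k * (D ℕ.+ A) Cℤ (D ℕ.+ k)
  ≡ (A ℕ.+ A) Cℤ (A ℕ.+ k) ^ s * (B ℕ.+ B) Cℤ (B ℕ.+ k) ^ r * (D ℕ.+ D) Cℤ (D ℕ.+ k) ^ t
    * ((A ℕ.+ B) Cℤ (A ℕ.+ k) * (B ℕ.+ D) Cℤ (B ℕ.+ k) * (D ℕ.+ A) Cℤ (D ℕ.+ k))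
pathProduct-blocks A B D s r t k = begin
  links (A ∷ blocks A B D s r t) D k * dA
    ≡⟨ cong (_* dA) (links-repeat s A _ D k) ⟩
  cA ^ s * (aB * links (B ∷ (replicate r B ++ replicate t D)) D k) * dA
    ≡⟨ cong (λ y → cA ^ s * (aB * y) * dA) (links-repeat r B _ D k) ⟩
  cA ^ s * (aB * (cB ^ r * ((B ℕ.+ next (replicate t D) D) Cℤ (B ℕ.+ k) * links (replicate t D) D k))) * dA
    ≡⟨ cong₂ (λ x y → cA ^ s * (aB * (cB ^ r * ((B ℕ.+ x) Cℤ (B ℕ.+ k) * y))) * dA) (next-replicate t D) (links-replicate t D k) ⟩
  cA ^ s * (aB * (cB ^ r * (bD * cD ^ t))) * dA
    ≡⟨ shuffle (cA ^ s) (cB ^ r) (cD ^ t) aB bD dA ⟩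
  cA ^ s * cB ^ r * cD ^ t * (aB * bD * dA) ∎
  where
  cA = (A ℕ.+ A) Cℤ (A ℕ.+ k)
  cB = (B ℕ.+ B) Cℤ (B ℕ.+ k)
  cD = (D ℕ.+ D) Cℤ (D ℕ.+ k)
  aB = (A ℕ.+ B) Cℤ (A ℕ.+ k)
  bD = (B ℕ.+ D) Cℤ (B ℕ.+ k)
  dA = (D ℕ.+ A) Cℤ (D ℕ.+ k)

  shuffle : ∀ x y z u v w → x * (u * (y * (v * z))) * w ≡ x * y * z * (u * v * w)
  shuffle = solve-∀

opaque
  unfolding _Cℤ_

  pos-*-Cℤ₃ : ∀ a m i n j l h →
    + (a ℕ.* (m choose i ℕ.* n choose j ℕ.* l choose h)) ≡ + a * (m Cℤ i * n Cℤ j * l Cℤ h)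
  pos-*-Cℤ₃ a m i n j l h = begin
    + (a ℕ.* (m choose i ℕ.* n choose j ℕ.* l choose h))
      ≡⟨ ℤ.pos-* a _ ⟩
    + a * + (m choose i ℕ.* n choose j ℕ.* l choose h)
      ≡⟨ cong (+ a *_) (trans (ℤ.pos-* (m choose i ℕ.* n choose j) _) (cong (_* l Cℤ h) (ℤ.pos-* (m choose i) _))) ⟩
    + a * (m Cℤ i * n Cℤ j * l Cℤ h) ∎

-- One factor of each power is traded by `central-to-cyclic` for the three edges that join the
-- blocks; the remaining factors are the loops. The factorial equation defines Q with denominators
-- cleared, and it already includes the factor (D + A choose D) from `cyclic-sum`.
central-sum : ∀ {M} A B D {A₂ B₂ D₂ AB BD} s r t Q → A < M →
  A ℕ.+ A ≡ A₂ → B ℕ.+ B ≡ B₂ → D ℕ.+ D ≡ D₂ → A ℕ.+ B ≡ AB → B ℕ.+ D ≡ BD →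
  A₂ ! ℕ.* B₂ ! ℕ.* D₂ ! ≡ AB ! ℕ.* BD ! ℕ.* (D ! ℕ.* A !) ℕ.* Q →
  ∑[ k < M ] (ε k * ((A ℕ.+ A) Cℤ (A ℕ.+ k) ^ suc s * (B ℕ.+ B) Cℤ (B ℕ.+ k) ^ suc r * (D ℕ.+ D) Cℤ (D ℕ.+ k) ^ suc t))
  ≡ + Q * chain M D A (blocks A B D s r t)
central-sum {M} A B D s r t Q A<M refl refl refl refl refl hyp = ℤ.*-cancelˡ-≡ (+ F) _ _ {{F≢0}} (begin
  + F * ∑[ k < M ] (ε k * (cA k ^ suc s * cB k ^ suc r * cD k ^ suc t))
    ≡⟨ ∑-distribˡ M (+ F) _ ⟩
  ∑[ k < M ] (+ F * (ε k * (cA k ^ suc s * cB k ^ suc r * cD k ^ suc t)))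
    ≡⟨ ∑-cong M (λ k _ → pointwise k) ⟩
  ∑[ k < M ] (+ G * (ε k * (pathProduct A bs D k * (D ℕ.+ A) Cℤ (D ℕ.+ k))))
    ≡⟨ ∑-distribˡ M (+ G) _ ⟨
  + G * ∑[ k < M ] (ε k * (pathProduct A bs D k * (D ℕ.+ A) Cℤ (D ℕ.+ k)))
    ≡⟨ cong (+ G *_) (cyclic-sum A bs D A<M) ⟩
  + G * ((D ℕ.+ A) Cℤ D * chain M D A bs)
    ≡⟨ ℤ.*-assoc (+ G) _ _ ⟨
  + G * (D ℕ.+ A) Cℤ D * chain M D A bs
    ≡⟨ cong (_* chain M D A bs) G*C≡F*Q ⟩
  + F * + Q * chain M D A bs
    ≡⟨ ℤ.*-assoc (+ F) (+ Q) _ ⟩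
  + F * (+ Q * chain M D A bs) ∎)
  where
  bs = blocks A B D s r t
  F = (A ℕ.+ B) ! ℕ.* (B ℕ.+ D) ! ℕ.* (D ℕ.+ A) !
  G = (A ℕ.+ A) ! ℕ.* (B ℕ.+ B) ! ℕ.* (D ℕ.+ D) !
  cA cB cD aB bD dA : ℕ → ℤ
  cA k = (A ℕ.+ A) Cℤ (A ℕ.+ k)
  cB k = (B ℕ.+ B) Cℤ (B ℕ.+ k)
  cD k = (D ℕ.+ D) Cℤ (D ℕ.+ k)
  aB k = (A ℕ.+ B) Cℤ (A ℕ.+ k)
  bD k = (B ℕ.+ D) Cℤ (B ℕ.+ k)
  dA k = (D ℕ.+ A) Cℤ (D ℕ.+ k)

  F≢0 : ℕ.NonZero F
  F≢0 = ℕ.m*n≢0 _ _ {{(A ℕ.+ B) ℕ.!* (B ℕ.+ D) !≢0}} {{(D ℕ.+ A) ℕ.!≢0}}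

  cyclic : ∀ k → + F * (cA k * cB k * cD k) ≡ + G * (aB k * bD k * dA k)
  cyclic k = begin
    + F * (cA k * cB k * cD k)
      ≡⟨ pos-*-Cℤ₃ F (A ℕ.+ A) (A ℕ.+ k) (B ℕ.+ B) (B ℕ.+ k) (D ℕ.+ D) (D ℕ.+ k) ⟨
    + (F ℕ.* ((A ℕ.+ A) choose (A ℕ.+ k) ℕ.* (B ℕ.+ B) choose (B ℕ.+ k) ℕ.* (D ℕ.+ D) choose (D ℕ.+ k)))
      ≡⟨ cong +_ (central-to-cyclic A B D k) ⟩
    + (G ℕ.* ((A ℕ.+ B) choose (A ℕ.+ k) ℕ.* (B ℕ.+ D) choose (B ℕ.+ k) ℕ.* (D ℕ.+ A) choose (D ℕ.+ k)))
      ≡⟨ pos-*-Cℤ₃ G (A ℕ.+ B) (A ℕ.+ k) (B ℕ.+ D) (B ℕ.+ k) (D ℕ.+ A) (D ℕ.+ k) ⟩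
    + G * (aB k * bD k * dA k) ∎

  gather : ∀ f e a x b y d z → f * (e * (a * x * (b * y) * (d * z))) ≡ e * (x * y * z) * (f * (a * b * d))
  gather = solve-∀

  scatter : ∀ g e w u → e * w * (g * u) ≡ g * (e * (w * u))
  scatter = solve-∀

  pointwise : ∀ k → + F * (ε k * (cA k ^ suc s * cB k ^ suc r * cD k ^ suc t))
                  ≡ + G * (ε k * (pathProduct A bs D k * dA k))
  pointwise k = begin
    + F * (ε k * (cA k ^ suc s * cB k ^ suc r * cD k ^ suc t))
      ≡⟨ gather (+ F) (ε k) (cA k) (cA k ^ s) (cB k) (cB k ^ r) (cD k) (cD k ^ t) ⟩
    ε k * (cA k ^ s * cB k ^ r * cD k ^ t) * (+ F * (cA k * cB k * cD k))
      ≡⟨ cong (ε k * (cA k ^ s * cB k ^ r * cD k ^ t) *_) (cyclic k) ⟩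
    ε k * (cA k ^ s * cB k ^ r * cD k ^ t) * (+ G * (aB k * bD k * dA k))
      ≡⟨ scatter (+ G) (ε k) (cA k ^ s * cB k ^ r * cD k ^ t) (aB k * bD k * dA k) ⟩
    + G * (ε k * (cA k ^ s * cB k ^ r * cD k ^ t * (aB k * bD k * dA k)))
      ≡⟨ cong (λ y → + G * (ε k * y)) (pathProduct-blocks A B D s r t k) ⟨
    + G * (ε k * (pathProduct A bs D k * dA k)) ∎

  reorder₁ : ∀ g c d → g ℕ.* c ℕ.* d ≡ g ℕ.* (c ℕ.* d)
  reorder₁ = ℕ-Solver.solve-∀

  reorder₂ : ∀ x y z q w → x ℕ.* y ℕ.* z ℕ.* q ℕ.* w ≡ x ℕ.* y ℕ.* w ℕ.* q ℕ.* z
  reorder₂ = ℕ-Solver.solve-∀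

  G*c≡F*Q : G ℕ.* (D ℕ.+ A) choose D ≡ F ℕ.* Q
  G*c≡F*Q = ℕ.*-cancelʳ-≡ _ _ (D ! ℕ.* A !) {{D ℕ.!* A !≢0}} (begin
    G ℕ.* (D ℕ.+ A) choose D ℕ.* (D ! ℕ.* A !)
      ≡⟨ reorder₁ G _ _ ⟩
    G ℕ.* ((D ℕ.+ A) choose D ℕ.* (D ! ℕ.* A !))
      ≡⟨ cong₂ ℕ._*_ hyp (choose-! D A) ⟩
    (A ℕ.+ B) ! ℕ.* (B ℕ.+ D) ! ℕ.* (D ! ℕ.* A !) ℕ.* Q ℕ.* (D ℕ.+ A) !
      ≡⟨ reorder₂ ((A ℕ.+ B) !) ((B ℕ.+ D) !) (D ! ℕ.* A !) Q ((D ℕ.+ A) !) ⟩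
    F ℕ.* Q ℕ.* (D ! ℕ.* A !) ∎)

  G*C≡F*Q : + G * (D ℕ.+ A) Cℤ D ≡ + F * + Q
  G*C≡F*Q = begin
    + G * (D ℕ.+ A) Cℤ D           ≡⟨ cong (+ G *_) (Cℤ≡choose (D ℕ.+ A) D) ⟩
    + G * + ((D ℕ.+ A) choose D)   ≡⟨ ℤ.pos-* G _ ⟨
    + (G ℕ.* (D ℕ.+ A) choose D)   ≡⟨ cong +_ G*c≡F*Q ⟩
    + (F ℕ.* Q)                    ≡⟨ ℤ.pos-* F Q ⟩
    + F * + Q                      ∎

-- Folding the sum over -n, ..., n

foldr-applyUpTo : ∀ n (f : ℕ → ℤ) → foldr _+_ 0ℤ (applyUpTo f n) ≡ ∑ n f
foldr-applyUpTo zero    f = sym (∑-empty f)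
foldr-applyUpTo (suc n) f = trans (cong (λ y → f 0 + y) (foldr-applyUpTo n (f ∘ suc))) (sym (∑-head n f))

∑±-unfold : ∀ n (f : ℤ → ℤ) → ∑±[ n ] f ≡ ∑[ i < suc (2 ℕ.* n) ] f (i ⊖ n)
∑±-unfold n f = begin
  foldr _+_ 0ℤ (map f (map (λ i → + i - + n) (upTo m)))
    ≡⟨ cong (λ xs → foldr _+_ 0ℤ (map f xs)) (map-applyUpTo (λ i → i) (λ i → + i - + n) m) ⟩
  foldr _+_ 0ℤ (map f (applyUpTo (λ i → + i - + n) m))
    ≡⟨ cong (foldr _+_ 0ℤ) (map-applyUpTo (λ i → + i - + n) f m) ⟩
  foldr _+_ 0ℤ (applyUpTo (λ i → f (+ i - + n)) m)
    ≡⟨ foldr-applyUpTo m _ ⟩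
  ∑[ i < m ] f (+ i - + n)
    ≡⟨ ∑-cong m (λ i _ → cong f (ℤ.m-n≡m⊖n i n)) ⟩
  ∑[ i < m ] f (i ⊖ n) ∎
  where m = suc (2 ℕ.* n)

-- The induction peels off both ends, -(n + 1) and n + 1, and shifts what lies between.
∑⊖-fold : ∀ n (f : ℤ → ℤ) → ∑[ i < suc (2 ℕ.* n) ] f (i ⊖ n) ≡ f 0ℤ + ∑[ k < n ] (f (+ suc k) + f -[1+ k ])
∑⊖-fold zero    f = trans (∑-head 0 _) (cong (λ y → f 0ℤ + y) (trans (∑-empty _) (sym (∑-empty _))))
∑⊖-fold (suc n) f = begin
  ∑[ i < suc (2 ℕ.* suc n) ] f (i ⊖ suc n)
    ≡⟨ cong (λ m → ∑[ i < suc m ] f (i ⊖ suc n)) (ℕ.*-suc 2 n) ⟩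
  ∑[ i < suc (suc m) ] f (i ⊖ suc n)
    ≡⟨ ∑-head (suc m) _ ⟩
  f -[1+ n ] + ∑[ i < suc m ] f (suc i ⊖ suc n)
    ≡⟨ cong (λ y → f -[1+ n ] + y) (trans (∑-cong (suc m) (λ i _ → cong f (ℤ.[1+m]⊖[1+n]≡m⊖n i n))) (∑-last m _)) ⟩
  f -[1+ n ] + (∑[ i < m ] f (i ⊖ n) + f (m ⊖ n))
    ≡⟨ cong₂ (λ y z → f -[1+ n ] + (y + f z)) (∑⊖-fold n f) m⊖n≡1+n ⟩
  f -[1+ n ] + (f 0ℤ + ∑[ k < n ] (f (+ suc k) + f -[1+ k ]) + f (+ suc n))
    ≡⟨ rearrange (f -[1+ n ]) (f 0ℤ) (∑[ k < n ] (f (+ suc k) + f -[1+ k ])) (f (+ suc n)) ⟩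
  f 0ℤ + (∑[ k < n ] (f (+ suc k) + f -[1+ k ]) + (f (+ suc n) + f -[1+ n ]))
    ≡⟨ cong (λ y → f 0ℤ + y) (∑-last n _) ⟨
  f 0ℤ + ∑[ k < suc n ] (f (+ suc k) + f -[1+ k ]) ∎
  where
  m = suc (2 ℕ.* n)

  m⊖n≡1+n : m ⊖ n ≡ + suc n
  m⊖n≡1+n = begin
    suc (n ℕ.+ (n ℕ.+ 0)) ⊖ n ≡⟨ cong (λ i → suc (n ℕ.+ i) ⊖ n) (ℕ.+-identityʳ n) ⟩
    suc n ℕ.+ n ⊖ n           ≡⟨ ℤ.⊖-≥ (ℕ.m≤n+m n (suc n)) ⟩
    + (suc n ℕ.+ n ℕ.∸ n)     ≡⟨ cong +_ (ℕ.m+n∸n≡m (suc n) n) ⟩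
    + suc n                   ∎

  rearrange : ∀ p q r s → p + (q + r + s) ≡ q + (r + (s + p))
  rearrange = solve-∀

∑±-even : ∀ n (f : ℤ → ℤ) (h : ℕ → ℤ) → (∀ k → f (+ k) ≡ -1ℤ ^ k * h k) → (∀ k → f -[1+ k ] ≡ -1ℤ ^ suc k * h (suc k)) →
          ∑±[ n ] f ≡ ∑[ k < suc n ] (ε k * h k)
∑±-even n f h f⁺ f⁻ = begin
  ∑±[ n ] f
    ≡⟨ trans (∑±-unfold n f) (∑⊖-fold n f) ⟩
  f 0ℤ + ∑[ k < n ] (f (+ suc k) + f -[1+ k ])
    ≡⟨ cong₂ _+_ (f⁺ 0) (∑-cong n (λ k _ → trans (cong₂ _+_ (f⁺ (suc k)) (f⁻ k)) (double (-1ℤ ^ suc k) (h (suc k))))) ⟩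
  1ℤ * h 0 + ∑[ k < n ] (ε (suc k) * h (suc k))
    ≡⟨ ∑-head n _ ⟨
  ∑[ k < suc n ] (ε k * h k) ∎
  where
  double : ∀ s x → s * x + s * x ≡ + 2 * s * x
  double = solve-∀

Cℤ≡C : ∀ n k → n Cℤ k ≡ + (n C k)
Cℤ≡C n k = trans (Cℤ≡choose n k) (cong +_ (choose≡C n k))

-- Symmetry of row 2a about its centre. For k ≥ a the left lower index is negative and the right one
-- exceeds 2a, so both values are 0.
binom-reflect : ∀ a k → binom (a ℕ.+ a) (+ a + -[1+ k ]) ≡ (a ℕ.+ a) Cℤ (a ℕ.+ suc k)
binom-reflect a k with suc k ℕ.≤? a
... | yes k<a with d , refl ← ℕ.m≤n⇒∃[o]m+o≡n k<a = begin
  binom (a ℕ.+ a) (a ⊖ suc k)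
    ≡⟨ cong (binom (a ℕ.+ a)) (trans (ℤ.⊖-≥ k<a) (cong +_ (ℕ.m+n∸m≡n (suc k) d))) ⟩
  + ((a ℕ.+ a) C d)
    ≡⟨ Cℤ≡C (a ℕ.+ a) d ⟨
  (a ℕ.+ a) Cℤ d
    ≡⟨ cong (_Cℤ d) a+a ⟩
  (a ℕ.+ suc k ℕ.+ d) Cℤ d
    ≡⟨ Cℤ-sym (a ℕ.+ suc k) d ⟨
  (a ℕ.+ suc k ℕ.+ d) Cℤ (a ℕ.+ suc k)
    ≡⟨ cong (_Cℤ (a ℕ.+ suc k)) a+a ⟨
  (a ℕ.+ a) Cℤ (a ℕ.+ suc k) ∎
  where
  a+a : a ℕ.+ a ≡ a ℕ.+ suc k ℕ.+ d
  a+a = sym (ℕ.+-assoc a (suc k) d)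
... | no k≮a with d , refl ← ℕ.m≤n⇒∃[o]m+o≡n (ℕ.≮⇒≥ k≮a) = begin
  binom (a ℕ.+ a) (a ⊖ suc (a ℕ.+ d))
    ≡⟨ cong (binom (a ℕ.+ a)) a⊖1+a+d ⟩
  0ℤ
    ≡⟨ Cℤ-zero (ℕ.+-monoʳ-< a (s≤s (ℕ.m≤m+n a d))) ⟨
  (a ℕ.+ a) Cℤ (a ℕ.+ suc (a ℕ.+ d)) ∎
  where
  a⊖1+a+d : a ⊖ suc (a ℕ.+ d) ≡ -[1+ d ]
  a⊖1+a+d = begin
    a ⊖ suc (a ℕ.+ d)               ≡⟨ ℤ.⊖-< (s≤s (ℕ.m≤m+n a d)) ⟩
    - + (suc (a ℕ.+ d) ℕ.∸ a)       ≡⟨ cong (λ i → - + (i ℕ.∸ a)) (ℕ.+-suc a d) ⟨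
    - + (a ℕ.+ suc d ℕ.∸ a)         ≡⟨ cong (λ i → - + i) (ℕ.m+n∸m≡n a (suc d)) ⟩
    -[1+ d ]                        ∎

summand : (m₁ a₁ r m₂ a₂ s m₃ a₃ t : ℕ) → ℤ → ℤ
summand m₁ a₁ r m₂ a₂ s m₃ a₃ t k =
  [-1]^ k * binom m₁ (+ a₁ + k) ^ r * binom m₂ (+ a₂ + k) ^ s * binom m₃ (+ a₃ + k) ^ t

-- The exponent `suc t` is positive, so the factor (2n choose n + k) makes every term with k > n
-- vanish, and the range can be widened to any `M` above n.
∑±-summand : ∀ {M} n {m₁ m₂ m₃} a₁ r a₂ s t → n < M → a₁ ℕ.+ a₁ ≡ m₁ → a₂ ℕ.+ a₂ ≡ m₂ → n ℕ.+ n ≡ m₃ →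
  ∑±[ n ] (summand m₁ a₁ r m₂ a₂ s m₃ n (suc t))
  ≡ ∑[ k < M ] (ε k * ((a₁ ℕ.+ a₁) Cℤ (a₁ ℕ.+ k) ^ r * (a₂ ℕ.+ a₂) Cℤ (a₂ ℕ.+ k) ^ s * (n ℕ.+ n) Cℤ (n ℕ.+ k) ^ suc t))
∑±-summand {M} n a₁ r a₂ s t n<M refl refl refl = begin
  ∑±[ n ] (summand _ a₁ r _ a₂ s _ n (suc t))
    ≡⟨ ∑±-even n (summand (a₁ ℕ.+ a₁) a₁ r (a₂ ℕ.+ a₂) a₂ s (n ℕ.+ n) n (suc t)) h pos neg ⟩
  ∑[ k < suc n ] (ε k * h k)
    ≡⟨ ∑-truncate _ n<M (λ k n<k _ → vanish k n<k) ⟨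
  ∑[ k < M ] (ε k * h k) ∎
  where
  c : ℕ → ℕ → ℤ
  c a k = (a ℕ.+ a) Cℤ (a ℕ.+ k)

  h : ℕ → ℤ
  h k = c a₁ k ^ r * c a₂ k ^ s * c n k ^ suc t

  assoc : ∀ w x y z → w * x * y * z ≡ w * (x * y * z)
  assoc = solve-∀

  combine : ∀ e k {b₁ b₂ b₃} → b₁ ≡ c a₁ k → b₂ ≡ c a₂ k → b₃ ≡ c n k →
            e * b₁ ^ r * b₂ ^ s * b₃ ^ suc t ≡ e * h k
  combine e k refl refl refl = assoc e (c a₁ k ^ r) (c a₂ k ^ s) (c n k ^ suc t)

  pos : ∀ k → summand (a₁ ℕ.+ a₁) a₁ r (a₂ ℕ.+ a₂) a₂ s (n ℕ.+ n) n (suc t) (+ k) ≡ -1ℤ ^ k * h k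
  pos k = combine (-1ℤ ^ k) k (sym (Cℤ≡C (a₁ ℕ.+ a₁) (a₁ ℕ.+ k))) (sym (Cℤ≡C (a₂ ℕ.+ a₂) (a₂ ℕ.+ k))) (sym (Cℤ≡C (n ℕ.+ n) (n ℕ.+ k)))

  neg : ∀ k → summand (a₁ ℕ.+ a₁) a₁ r (a₂ ℕ.+ a₂) a₂ s (n ℕ.+ n) n (suc t) -[1+ k ] ≡ -1ℤ ^ suc k * h (suc k)
  neg k = combine (-1ℤ ^ suc k) (suc k) (binom-reflect a₁ k) (binom-reflect a₂ k) (binom-reflect n k)

  vanish : ∀ k → n < k → ε k * h k ≡ 0ℤ
  vanish k n<k = begin
    ε k * (c a₁ k ^ r * c a₂ k ^ s * (c n k * c n k ^ t))
      ≡⟨ cong (λ y → ε k * (c a₁ k ^ r * c a₂ k ^ s * (y * c n k ^ t))) (Cℤ-zero (ℕ.+-monoʳ-< n n<k)) ⟩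
    ε k * (c a₁ k ^ r * c a₂ k ^ s * 0ℤ)
      ≡⟨ cong (ε k *_) (ℤ.*-zeroʳ (c a₁ k ^ r * c a₂ k ^ s)) ⟩
    ε k * 0ℤ
      ≡⟨ ℤ.*-zeroʳ (ε k) ⟩
    0ℤ ∎

-- Choice of the prime power and of the obstructing edge

prime[3] : Prime 3
prime[3] = from-yes (prime? 3)

-- The exponent is one more than that of p in n, so p ^ f is the least power of p not dividing n;
-- the recursion strips factors p from n.
maximal-power : ∀ {p} → Prime p → ∀ n → n ≢ 0 → ∃ λ f → p ℕ.^ f ℕ.∣ p ℕ.* n × ¬ p ℕ.^ f ℕ.∣ n
maximal-power {p} pr = <-rec _ step
  where
  instance
    p≢0 : ℕ.NonZero p
    p≢0 = prime⇒nonZero pr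

  m≢0 : ∀ m → m ℕ.* p ≢ 0 → m ≢ 0
  m≢0 m mp≢0 refl = mp≢0 refl

  step : ∀ n → (∀ {m} → m < n → m ≢ 0 → ∃ λ f → p ℕ.^ f ℕ.∣ p ℕ.* m × ¬ p ℕ.^ f ℕ.∣ m) →
         n ≢ 0 → ∃ λ f → p ℕ.^ f ℕ.∣ p ℕ.* n × ¬ p ℕ.^ f ℕ.∣ n
  step n rec n≢0 with p ℕ.∣? n
  ... | no p∤n = 1 , subst (ℕ._∣ p ℕ.* n) (sym (ℕ.*-identityʳ p)) (ℕ.m∣m*n n)
                   , λ p¹∣n → p∤n (subst (ℕ._∣ n) (ℕ.*-identityʳ p) p¹∣n)
  ... | yes (ℕ.divides m refl)
    with f , q∣pm , q∤m ← rec (ℕ.m<m*n m p {{ℕ.≢-nonZero (m≢0 m n≢0)}} (ℕ.nonTrivial⇒n>1 p {{prime⇒nonTrivial pr}})) (m≢0 m n≢0)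
    = suc f , subst (p ℕ.^ suc f ℕ.∣_) (cong (p ℕ.*_) (ℕ.*-comm p m)) (ℕ.*-monoʳ-∣ p q∣pm)
            , λ q∣n → q∤m (ℕ.*-cancelˡ-∣ p (subst (p ℕ.^ suc f ℕ.∣_) (ℕ.*-comm m p) q∣n))

Obstructed-++ : ∀ {q} s A {bs N} → Obstructed q bs N → Obstructed q (replicate s A ++ bs) N
Obstructed-++ zero    A o = o
Obstructed-++ (suc s) A o = inj₂ (Obstructed-++ s A o)

-- The edge from the last B to the first D. For t = 0 that D is the final vertex of the cycle, which
-- `next-replicate` takes into account.
Obstructed-BD : ∀ {q} A B D s r t → q ℕ.∣ B ℕ.+ D → ¬ q ℕ.∣ D → Obstructed q (blocks A B D s r t) D
Obstructed-BD {q} A B D s r t q∣B+D q∤D = Obstructed-++ s A (from-B r)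
  where
  from-B : ∀ r → Obstructed q (B ∷ (replicate r B ++ replicate t D)) D
  from-B zero    = inj₁ (subst (λ x → q ℕ.∣ B ℕ.+ x × ¬ q ℕ.∣ x) (sym (next-replicate t D)) (q∣B+D , q∤D))
  from-B (suc r) = inj₂ (from-B r)

Obstructed-BB : ∀ {q} A B D s r t → q ℕ.∣ B ℕ.+ B → ¬ q ℕ.∣ B → Obstructed q (blocks A B D s (suc r) t) D
Obstructed-BB A B D s r t q∣B+B q∤B = Obstructed-++ s A (inj₁ (q∣B+B , q∤B))

Obstructed-DD : ∀ {q} A B D s r t → q ℕ.∣ D ℕ.+ D → ¬ q ℕ.∣ D → Obstructed q (blocks A B D s r (suc t)) D
Obstructed-DD {q} A B D s r t q∣D+D q∤D = Obstructed-++ s A (inj₂ (Obstructed-++ r B (inj₁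
  (subst (λ x → q ℕ.∣ D ℕ.+ x × ¬ q ℕ.∣ x) (sym (next-replicate t D)) (q∣D+D , q∤D)))))

∣-quotient : ∀ d Q {T Z} → T ≡ + Q * Z → + d ∣ Z → + (d ℕ.* Q) ∣ T
∣-quotient d Q T≡QZ (divides z refl) = divides z (begin
  _                 ≡⟨ T≡QZ ⟩
  + Q * (z * + d)   ≡⟨ reorder (+ Q) z (+ d) ⟩
  z * (+ d * + Q)   ≡⟨ cong (z *_) (ℤ.pos-* d Q) ⟨
  z * + (d ℕ.* Q)   ∎)
  where
  reorder : ∀ q z d → q * (z * d) ≡ z * (d * q)
  reorder = solve-∀

-- Bézout's relation 3 - 2 = 1: each of 3T and 2T is a multiple of 6Q, and T is their difference.
∣-by-2-and-3 : ∀ Q {T} → + (2 ℕ.* Q) ∣ T → + (3 ℕ.* Q) ∣ T → + (6 ℕ.* Q) ∣ T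
∣-by-2-and-3 Q {T} (divides a T≡a*2Q) (divides b T≡b*3Q) = divides (a - b) (begin
  T                                               ≡⟨ difference T ⟩
  + 3 * T - + 2 * T                               ≡⟨ cong₂ (λ x y → + 3 * x - + 2 * y) T≡a*2Q T≡b*3Q ⟩
  + 3 * (a * + (2 ℕ.* Q)) - + 2 * (b * + (3 ℕ.* Q)) ≡⟨ cong₂ (λ x y → + 3 * (a * x) - + 2 * (b * y)) (ℤ.pos-* 2 Q) (ℤ.pos-* 3 Q) ⟩
  + 3 * (a * (+ 2 * + Q)) - + 2 * (b * (+ 3 * + Q)) ≡⟨ factor a b (+ Q) ⟩
  (a - b) * (+ 6 * + Q)                           ≡⟨ cong ((a - b) *_) (ℤ.pos-* 6 Q) ⟨
  (a - b) * + (6 ℕ.* Q)                           ∎)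
  where
  difference : ∀ t → t ≡ + 3 * t - + 2 * t
  difference = solve-∀
  factor : ∀ a b q → + 3 * (a * (+ 2 * q)) - + 2 * (b * (+ 3 * q)) ≡ (a - b) * (+ 6 * q)
  factor = solve-∀

-- The two sums of the theorem and their divisors

module _ (n : ℕ) (n≢0 : n ≢ 0) where
  private
    -- One bound for all sums: it exceeds n and each of the starting vertices 2n, 3n and 4n.
    M = suc (4 ℕ.* n)

    n+n : n ℕ.+ n ≡ 2 ℕ.* n
    n+n = cong (n ℕ.+_) (sym (ℕ.+-identityʳ n))

    _n+_n : ∀ a b → a ℕ.* n ℕ.+ b ℕ.* n ≡ (a ℕ.+ b) ℕ.* n
    a n+ b n = sym (ℕ.*-distribʳ-+ n a b)

    below : ∀ a → a ≤ 4 → a ℕ.* n < M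
    below a a≤4 = s≤s (ℕ.*-monoˡ-≤ n a≤4)

    n<M : n < M
    n<M = s≤s (ℕ.m≤m+n n (3 ℕ.* n))

    2n<M : 2 ℕ.* n < M
    2n<M = below 2 (ℕ.m≤m+n 2 2)

    3n<M : 3 ℕ.* n < M
    3n<M = below 3 (ℕ.m≤m+n 3 1)

    4n<M : 4 ℕ.* n < M
    4n<M = below 4 ℕ.≤-refl

    f : ℕ → ℕ
    f a = (a ℕ.* n) !

    yxz : ∀ x y z → x * y * z ≡ y * x * z
    yxz = solve-∀
    yzx : ∀ x y z → x * y * z ≡ y * z * x
    yzx = solve-∀
    xzy : ∀ x y z → x * y * z ≡ x * z * y
    xzy = solve-∀

    b : ℕ → ℕ → ℤ
    b a k = (a ℕ.+ a) Cℤ (a ℕ.+ k)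

    two : ∃ λ e → 2 ℕ.^ e ℕ.∣ 2 ℕ.* n × ¬ 2 ℕ.^ e ℕ.∣ n
    two = maximal-power prime[2] n n≢0

    three : ∃ λ e → 3 ℕ.^ e ℕ.∣ 3 ℕ.* n × ¬ 3 ℕ.^ e ℕ.∣ n
    three = maximal-power prime[3] n n≢0

    four : ∃ λ e → 2 ℕ.^ e ℕ.∣ 2 ℕ.* (2 ℕ.* n) × ¬ 2 ℕ.^ e ℕ.∣ 2 ℕ.* n
    four = maximal-power prime[2] (2 ℕ.* n) (λ 2n≡0 → n≢0 (ℕ.m+n≡0⇒m≡0 n 2n≡0))

    2[2n]≡4n : 2 ℕ.* (2 ℕ.* n) ≡ 4 ℕ.* n
    2[2n]≡4n = sym (ℕ.*-assoc 2 2 n)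

    ∣4n : ∀ {q} → q ℕ.∣ 2 ℕ.* n → q ℕ.∣ 4 ℕ.* n
    ∣4n {q} q∣2n = subst (q ℕ.∣_) 2[2n]≡4n (ℕ.∣n⇒∣m*n 2 q∣2n)

    2n+n≡3n : 2 ℕ.* n ℕ.+ n ≡ 3 ℕ.* n
    2n+n≡3n = ℕ.+-comm (2 ℕ.* n) n

  module _ (r s t : ℕ) where
    T₆ T₈ : ℤ
    T₆ = ∑±[ n ] (summand (6 ℕ.* n) (3 ℕ.* n) (suc r) (4 ℕ.* n) (2 ℕ.* n) (suc s) (2 ℕ.* n) n (suc t))
    T₈ = ∑±[ n ] (summand (8 ℕ.* n) (4 ℕ.* n) (suc r) (4 ℕ.* n) (2 ℕ.* n) (suc s) (2 ℕ.* n) n (suc t))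

    private
      fold₆ : T₆ ≡ ∑[ k < M ] (ε k * (b (3 ℕ.* n) k ^ suc r * b (2 ℕ.* n) k ^ suc s * b n k ^ suc t))
      fold₆ = ∑±-summand n (3 ℕ.* n) (suc r) (2 ℕ.* n) (suc s) t n<M (3 n+ 3 n) (2 n+ 2 n) n+n

      fold₈ : T₈ ≡ ∑[ k < M ] (ε k * (b (4 ℕ.* n) k ^ suc r * b (2 ℕ.* n) k ^ suc s * b n k ^ suc t))
      fold₈ = ∑±-summand n (4 ℕ.* n) (suc r) (2 ℕ.* n) (suc s) t n<M (4 n+ 4 n) (2 n+ 2 n) n+n

      3n+n : 3 ℕ.* n ℕ.+ n ≡ 4 ℕ.* n
      3n+n = ℕ.+-comm (3 ℕ.* n) n

    -- The digits of the name give the blocks A, B, D as multiples of n. Here Q is (4n)! (6n)! (2n)!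
    -- / ((5n)! (4n)! n! (2n)!); the lemmas for the other cycles differ only in this quotient and in
    -- the order of the powers.
    T₆-via-2-3-1 : T₆ ≡ + ((6 ℕ.* n) choose n) * chain M n (2 ℕ.* n) (blocks (2 ℕ.* n) (3 ℕ.* n) n s r t)
    T₆-via-2-3-1 = trans fold₆ (trans
      (∑-cong M (λ k _ → cong (ε k *_) (yxz (b (3 ℕ.* n) k ^ suc r) (b (2 ℕ.* n) k ^ suc s) (b n k ^ suc t))))
      (central-sum (2 ℕ.* n) (3 ℕ.* n) n s r t _ 2n<M (2 n+ 2 n) (3 n+ 3 n) n+n (2 n+ 3 n) 3n+n
        (trans (cong (λ x → f 4 ℕ.* x ℕ.* f 2) (sym (choose-! n (5 ℕ.* n)))) (rearrange ((6 ℕ.* n) choose n) (n !) (f 2) (f 4) (f 5)))))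
      where
      rearrange : ∀ c x₁ x₂ x₄ x₅ → x₄ ℕ.* (c ℕ.* (x₁ ℕ.* x₅)) ℕ.* x₂ ≡ x₅ ℕ.* x₄ ℕ.* (x₁ ℕ.* x₂) ℕ.* c
      rearrange = ℕ-Solver.solve-∀

    T₆-via-2-1-3 : T₆ ≡ + ((6 ℕ.* n) choose (3 ℕ.* n)) * chain M (3 ℕ.* n) (2 ℕ.* n) (blocks (2 ℕ.* n) n (3 ℕ.* n) s t r)
    T₆-via-2-1-3 = trans fold₆ (trans
      (∑-cong M (λ k _ → cong (ε k *_) (yzx (b (3 ℕ.* n) k ^ suc r) (b (2 ℕ.* n) k ^ suc s) (b n k ^ suc t))))
      (central-sum (2 ℕ.* n) n (3 ℕ.* n) s t r _ 2n<M (2 n+ 2 n) n+n (3 n+ 3 n) (ℕ.+-comm (2 ℕ.* n) n) refl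
        (trans (cong (λ x → f 4 ℕ.* f 2 ℕ.* x) 6n!) (rearrange ((6 ℕ.* n) choose (3 ℕ.* n)) (f 2) (f 3) (f 4)))))
      where
      6n! : f 6 ≡ (6 ℕ.* n) choose (3 ℕ.* n) ℕ.* (f 3 ℕ.* f 3)
      6n! = subst (λ m → m ! ≡ m choose (3 ℕ.* n) ℕ.* (f 3 ℕ.* f 3)) (3 n+ 3 n) (sym (choose-! (3 ℕ.* n) (3 ℕ.* n)))
      rearrange : ∀ c x₂ x₃ x₄ → x₄ ℕ.* x₂ ℕ.* (c ℕ.* (x₃ ℕ.* x₃)) ≡ x₃ ℕ.* x₄ ℕ.* (x₃ ℕ.* x₂) ℕ.* c
      rearrange = ℕ-Solver.solve-∀

    T₆-via-3-1-2 : T₆ ≡ + ((6 ℕ.* n) choose (3 ℕ.* n)) * chain M (2 ℕ.* n) (3 ℕ.* n) (blocks (3 ℕ.* n) n (2 ℕ.* n) r t s)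
    T₆-via-3-1-2 = trans fold₆ (trans
      (∑-cong M (λ k _ → cong (ε k *_) (xzy (b (3 ℕ.* n) k ^ suc r) (b (2 ℕ.* n) k ^ suc s) (b n k ^ suc t))))
      (central-sum (3 ℕ.* n) n (2 ℕ.* n) r t s _ 3n<M (3 n+ 3 n) n+n (2 n+ 2 n) 3n+n refl
        (trans (cong (λ x → x ℕ.* f 2 ℕ.* f 4) 6n!) (rearrange ((6 ℕ.* n) choose (3 ℕ.* n)) (f 2) (f 3) (f 4)))))
      where
      6n! : f 6 ≡ (6 ℕ.* n) choose (3 ℕ.* n) ℕ.* (f 3 ℕ.* f 3)
      6n! = subst (λ m → m ! ≡ m choose (3 ℕ.* n) ℕ.* (f 3 ℕ.* f 3)) (3 n+ 3 n) (sym (choose-! (3 ℕ.* n) (3 ℕ.* n)))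
      rearrange : ∀ c x₂ x₃ x₄ → c ℕ.* (x₃ ℕ.* x₃) ℕ.* x₂ ℕ.* x₄ ≡ x₄ ℕ.* x₃ ℕ.* (x₂ ℕ.* x₃) ℕ.* c
      rearrange = ℕ-Solver.solve-∀

    private
      8n! : f 8 ≡ (8 ℕ.* n) choose (3 ℕ.* n) ℕ.* (f 3 ℕ.* f 5)
      8n! = subst (λ m → m ! ≡ m choose (3 ℕ.* n) ℕ.* (f 3 ℕ.* f 5)) (3 n+ 5 n) (sym (choose-! (3 ℕ.* n) (5 ℕ.* n)))

    T₈-via-4-1-2 : T₈ ≡ + ((8 ℕ.* n) choose (3 ℕ.* n)) * chain M (2 ℕ.* n) (4 ℕ.* n) (blocks (4 ℕ.* n) n (2 ℕ.* n) r t s)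
    T₈-via-4-1-2 = trans fold₈ (trans
      (∑-cong M (λ k _ → cong (ε k *_) (xzy (b (4 ℕ.* n) k ^ suc r) (b (2 ℕ.* n) k ^ suc s) (b n k ^ suc t))))
      (central-sum (4 ℕ.* n) n (2 ℕ.* n) r t s _ 4n<M (4 n+ 4 n) n+n (2 n+ 2 n) (ℕ.+-comm (4 ℕ.* n) n) refl
        (trans (cong (λ x → x ℕ.* f 2 ℕ.* f 4) 8n!) (rearrange ((8 ℕ.* n) choose (3 ℕ.* n)) (f 2) (f 3) (f 4) (f 5)))))
      where
      rearrange : ∀ c x₂ x₃ x₄ x₅ → c ℕ.* (x₃ ℕ.* x₅) ℕ.* x₂ ℕ.* x₄ ≡ x₅ ℕ.* x₃ ℕ.* (x₂ ℕ.* x₄) ℕ.* c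
      rearrange = ℕ-Solver.solve-∀

    T₈-via-2-1-4 : T₈ ≡ + ((8 ℕ.* n) choose (3 ℕ.* n)) * chain M (4 ℕ.* n) (2 ℕ.* n) (blocks (2 ℕ.* n) n (4 ℕ.* n) s t r)
    T₈-via-2-1-4 = trans fold₈ (trans
      (∑-cong M (λ k _ → cong (ε k *_) (yzx (b (4 ℕ.* n) k ^ suc r) (b (2 ℕ.* n) k ^ suc s) (b n k ^ suc t))))
      (central-sum (2 ℕ.* n) n (4 ℕ.* n) s t r _ 2n<M (2 n+ 2 n) n+n (4 n+ 4 n) (ℕ.+-comm (2 ℕ.* n) n) refl
        (trans (cong (λ x → f 4 ℕ.* f 2 ℕ.* x) 8n!) (rearrange ((8 ℕ.* n) choose (3 ℕ.* n)) (f 2) (f 3) (f 4) (f 5)))))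
      where
      rearrange : ∀ c x₂ x₃ x₄ x₅ → x₄ ℕ.* x₂ ℕ.* (c ℕ.* (x₃ ℕ.* x₅)) ≡ x₃ ℕ.* x₅ ℕ.* (x₄ ℕ.* x₂) ℕ.* c
      rearrange = ℕ-Solver.solve-∀

    -- With q the least power of 2 not dividing n, the start 2n is divisible by q and the edge (3n,
    -- n) obstructs: q ∣ 4n but q ∤ n.
    T₆-by-6nCn : + (2 ℕ.* (6 ℕ.* n) choose n) ∣ T₆
    T₆-by-6nCn with e , q∣2n , q∤n ← two = ∣-quotient 2 ((6 ℕ.* n) choose n) T₆-via-2-3-1
      (chain-∣ prime[2] e (2 ℕ.* n) (blocks (2 ℕ.* n) (3 ℕ.* n) n s r t)
        (Obstructed-BD (2 ℕ.* n) (3 ℕ.* n) n s r t (subst (2 ℕ.^ e ℕ.∣_) (sym 3n+n) (∣4n q∣2n)) q∤n) q∣2n)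

    -- The primes use different cycles. For 2 the start is 2n and the edge (n, 3n) obstructs, since
    -- q ∣ 4n; for 3 the start is 3n and the edge (n, 2n) obstructs, since q ∣ 3n. In both cases q
    -- dividing the end of the edge would force q ∣ n.
    T₆-by-6nC3n : + (6 ℕ.* (6 ℕ.* n) choose (3 ℕ.* n)) ∣ T₆
    T₆-by-6nC3n = ∣-by-2-and-3 ((6 ℕ.* n) choose (3 ℕ.* n)) by-2 by-3
      where
      by-2 : + (2 ℕ.* (6 ℕ.* n) choose (3 ℕ.* n)) ∣ T₆
      by-2 with e , q∣2n , q∤n ← two = ∣-quotient 2 ((6 ℕ.* n) choose (3 ℕ.* n)) T₆-via-2-1-3
        (chain-∣ prime[2] e (2 ℕ.* n) (blocks (2 ℕ.* n) n (3 ℕ.* n) s t r)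
          (Obstructed-BD (2 ℕ.* n) n (3 ℕ.* n) s t r (∣4n q∣2n)
            (λ q∣3n → q∤n (ℕ.∣m+n∣m⇒∣n (subst (2 ℕ.^ e ℕ.∣_) (sym 2n+n≡3n) q∣3n) q∣2n))) q∣2n)

      by-3 : + (3 ℕ.* (6 ℕ.* n) choose (3 ℕ.* n)) ∣ T₆
      by-3 with e , q∣3n , q∤n ← three = ∣-quotient 3 ((6 ℕ.* n) choose (3 ℕ.* n)) T₆-via-3-1-2
        (chain-∣ prime[3] e (3 ℕ.* n) (blocks (3 ℕ.* n) n (2 ℕ.* n) r t s)
          (Obstructed-BD (3 ℕ.* n) n (2 ℕ.* n) r t s q∣3n
            (λ q∣2n → q∤n (ℕ.∣m+n∣m⇒∣n (subst (3 ℕ.^ e ℕ.∣_) (sym 2n+n≡3n) q∣3n) q∣2n))) q∣3n)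

  T₈-by-8nC3n : ∀ r s t → (r , s , t) ≢ (0 , 0 , 0) → + (2 ℕ.* (8 ℕ.* n) choose (3 ℕ.* n)) ∣ T₈ r s t
  -- The arguments are the exponents less one. A second factor of (4n choose 2n + k) gives a loop at
  -- 2n, which obstructs for the least power of 2 not dividing 2n.
  T₈-by-8nC3n r (suc s) t _ with e , q∣2[2n] , q∤2n ← four =
    ∣-quotient 2 ((8 ℕ.* n) choose (3 ℕ.* n)) (T₈-via-4-1-2 r (suc s) t)
      (chain-∣ prime[2] e (4 ℕ.* n) (blocks (4 ℕ.* n) n (2 ℕ.* n) r t (suc s))
        (Obstructed-DD (4 ℕ.* n) n (2 ℕ.* n) r t s (subst (2 ℕ.^ e ℕ.∣_) (sym (2 n+ 2 n)) q∣4n) q∤2n) q∣4n)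
    where
    q∣4n : 2 ℕ.^ e ℕ.∣ 4 ℕ.* n
    q∣4n = subst (2 ℕ.^ e ℕ.∣_) 2[2n]≡4n q∣2[2n]
  -- Now the loop at n obstructs, for the least power of 2 not dividing n.
  T₈-by-8nC3n r zero (suc t) _ with e , q∣2n , q∤n ← two =
    ∣-quotient 2 ((8 ℕ.* n) choose (3 ℕ.* n)) (T₈-via-4-1-2 r 0 (suc t))
      (chain-∣ prime[2] e (4 ℕ.* n) (blocks (4 ℕ.* n) n (2 ℕ.* n) r (suc t) 0)
        (Obstructed-BB (4 ℕ.* n) n (2 ℕ.* n) r t 0 (subst (2 ℕ.^ e ℕ.∣_) (sym n+n) q∣2n) q∤n) (∣4n q∣2n))
  -- The only loops left are at 4n; the cycle is restarted at 2n so that r ≥ 2 supplies the edge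
  -- (4n, 4n) used by `chain-even`.
  T₈-by-8nC3n (suc r) zero zero _ =
    ∣-quotient 2 ((8 ℕ.* n) choose (3 ℕ.* n)) (T₈-via-2-1-4 (suc r) 0 0)
      (chain-even n (replicate r (4 ℕ.* n)) n≢0 2n<M (next-replicate r (4 ℕ.* n)))
  T₈-by-8nC3n zero zero zero ≢ = contradiction refl ≢

∣⇒≡0[mod] : ∀ {m T} → + m ∣ T → T ≡ 0ℤ [mod m ]
∣⇒≡0[mod] {m} {T} = subst (+ m ∣_) (sym (ℤ.+-identityʳ T))

mainTheorem4 : (r s t n : ℕ) → r ≥ 1 → s ≥ 1 → t ≥ 1 → n ≥ 1 →
    (∑±[ n ] (λ k → [-1]^ k * binom (6 ℕ.* n) (+ (3 ℕ.* n) + k) ^ r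
    * binom (4 ℕ.* n) (+ (2 ℕ.* n) + k) ^ s
    * binom (2 ℕ.* n) (+ n + k) ^ t)
    ≡ 0ℤ [mod 2 ℕ.* ((6 ℕ.* n) C n) ])
    × (∑±[ n ] (λ k → [-1]^ k * binom (6 ℕ.* n) (+ (3 ℕ.* n) + k) ^ r
    * binom (4 ℕ.* n) (+ (2 ℕ.* n) + k) ^ s
    * binom (2 ℕ.* n) (+ n + k) ^ t)
    ≡ 0ℤ [mod 6 ℕ.* ((6 ℕ.* n) C (3 ℕ.* n)) ])
    × ((r , s , t) ≢ (1 , 1 , 1) →
    ∑±[ n ] (λ k → [-1]^ k * binom (8 ℕ.* n) (+ (4 ℕ.* n) + k) ^ r
    * binom (4 ℕ.* n) (+ (2 ℕ.* n) + k) ^ s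
    * binom (2 ℕ.* n) (+ n + k) ^ t)
    ≡ 0ℤ [mod 2 ℕ.* ((8 ℕ.* n) C (3 ℕ.* n)) ])
mainTheorem4 (suc r) (suc s) (suc t) n _ _ _ n≥1 =
    ∣⇒≡0[mod] (subst (λ c → + (2 ℕ.* c) ∣ T₆ n n≢0 r s t) (choose≡C (6 ℕ.* n) n) (T₆-by-6nCn n n≢0 r s t))
  , ∣⇒≡0[mod] (subst (λ c → + (6 ℕ.* c) ∣ T₆ n n≢0 r s t) (choose≡C (6 ℕ.* n) (3 ℕ.* n)) (T₆-by-6nC3n n n≢0 r s t))
  , λ rst≢111 → ∣⇒≡0[mod] (subst (λ c → + (2 ℕ.* c) ∣ T₈ n n≢0 r s t) (choose≡C (8 ℕ.* n) (3 ℕ.* n))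
      (T₈-by-8nC3n n n≢0 r s t λ { refl → rst≢111 refl }))
  where
  n≢0 : n ≢ 0
  n≢0 = ℕ.m<n⇒n≢0 n≥1
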